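{- Let $P$ be a robustly typed, input-linear program with input selectability and $p$ a predicate in $P$. Suppose all predicates $q$ with $p\sqsupset q$ are robust, and all clauses defining predicates $q$ with $q\approx p$ are well-recurrent with respect to some (one and the same) moded typed level mapping $|.|$. Then $p$ is robust.
   Context: Basics. A query is a finite sequence of atoms; a clause is $h\leftarrow B$ with $h$ an atom and $B$ a query. Every predicate has a fixed mode, i.e. each argument position is either input or output; $p(\mathbf s,\mathbf t)$ denotes an atom with $\mathbf s$ (resp. $\mathbf t$) the vector of terms filling the input (resp. output) positions. In clause heads $p(\mathbf t_0,\mathbf s_{n+1})$, $\mathbf t_0$ is the input and $\mathbf s_{n+1}$ the output. A syntactic object is linear if each variable occurs in it at most once. A clause is input-linear if the vector of input terms of its head is linear; a program is input-linear if all its clauses are and it does not use the equality predicate $=$ with both arguments input. A flat term is a variable or a term $f(x_1,\dots,x_n)$, $n\ge 0$, with distinct variables $x_i$. Types. A type is a non-empty set of terms closed under instantiation. The variable type is the type of all terms; any other type is a non-variable type. Each argument position of each predicate has an associated type. $t:T$ means $t\in T$ (componentwise for vectors); an atom is correctly typed in a position if the term there belongs to the type of the position. $\models \varphi\Rightarrow \mathbf t:\mathbf T$ means that the implication holds after applying any substitution to all terms. A term is type-consistent (in a position of type $T$) if some instance of it is in $T$. Nicely moded. $Q=p_1(\mathbf s_1,\mathbf t_1),\dots,p_n(\mathbf s_n,\mathbf t_n)$ is nicely moded if $\mathbf t_1,\dots,\mathbf t_n$ is linear and for all $i$, $vars(\mathbf s_i)\cap\bigcup_{i\le j\le n}vars(\mathbf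 t_j)=\emptyset$. A clause $p(\mathbf t_0,\mathbf s_{n+1})\leftarrow Q$ is nicely moded if $Q$ is and $vars(\mathbf t_0)\cap\bigcup_{j=1}^n vars(\mathbf t_j)=\emptyset$. Well typed. With $p_i(\mathbf S_i,\mathbf T_i)$ the type of $p_i$, $Q$ is well typed if for all $i\in\{1,\dots,n\}$, $\models(\bigwedge_{1\le j<i}\mathbf t_j:\mathbf T_j)\Rightarrow\mathbf s_i:\mathbf S_i$. A clause $p(\mathbf t_0,\mathbf s_{n+1})\leftarrow Q$, with $p(\mathbf T_0,\mathbf S_{n+1})$ the type of $p$, is well typed if for all $i\in\{1,\dots,n+1\}$, $\models(\bigwedge_{0\le j<i}\mathbf t_j:\mathbf T_j)\Rightarrow\mathbf s_i:\mathbf S_i$. Bound/free (relative to a well typed program $P$). An input position of $p$ is bound if some clause head $p(\dots)$ in $P$ has a non-variable term there; an output position of $p$ is bound if some body atom $p(\dots)$ in $P$ has a non-variable term there; otherwise the position is free. $\mathbf r^{\sf f},\mathbf r^{\sf b}$ are the projections of $\mathbf r$ onto its free/bound positions. Robustly typed (relative to a well typed program $P$ whose bound positions are of non-variable type). $Q$ is robustly typed if it is nicely moded and well typed, $\mathbf t_1^{\sf f},\dots,\mathbf t_n^{\sf f}$ is a vector of variables and $\mathbf t_1^{\sf b},\dots,\mathbf t_n^{\sf b}$ a vector of flat type-consistent terms. A clause $p(\mathbf t_0,\mathbf s_{n+1})\leftarrow Q$ is robustly typed if it is nicely moded and well typed; $\mathbf t_0^{\sf f},\dots,\mathbf t_n^{\sf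 f}$ is a vector of variables and $\mathbf t_0^{\sf b},\dots,\mathbf t_n^{\sf b}$ a vector of flat type-consistent terms; and if a position of type $\tau$ in $\mathbf s_{n+1}^{\sf b}$ is filled with a variable $x$, then $x$ also fills a position of type $\tau$ in $\mathbf t_0^{\sf b},\dots,\mathbf t_n^{\sf b}$. A program is robustly typed if all its clauses are. Derivations. A program consists of clauses and, for each predicate $p/n$, a block declaration: a (possibly empty) set of atoms $p(b_1,\dots,b_n)$ with $b_i\in\{?,-\}$. An atom $p(t_1,\dots,t_n)$ is blocked if for some $p(b_1,\dots,b_n)$ in the declaration, $t_i$ is a variable for all $i$ with $b_i=-$; otherwise it is selectable. In a derivation step a query $Q_1,a,Q_2$ is replaced by $(Q_1,B,Q_2)\theta$, where $h\leftarrow B$ is a variant, renamed apart, of a program clause and $\theta$ is a most general unifier of the selected atom $a$ and $h$. A derivation of $P\cup\{Q\}$ is a (finite or infinite) sequence of such steps starting at $Q$; it is delay-respecting if the selected atom is always selectable. Input selectability. $P$ has input selectability if every atom (using a predicate of $P$) that has variables in all free output positions is selectable in $P$ (1) only if it is non-variable in all bound input positions, and (2) if it is non-variable in all input positions of non-variable type. Robust. A predicate $p$ in $P$ is robust if for each robustly typed query $p(\mathbf s,\mathbf t)$ consisting of one atom, every delay-respecting derivation of $P\cup\{p(\mathbf s,\mathbf t)\}$ is finite. Depends on. $p$ refers to $q$ if some clause of $P$ has $p$ in its head and $q$ in its body; $p\sqsupseteq q$ is the reflexive transitive closure of this relation; $p\sqsupset q$ means $p\sqsupseteq q$ and $q\not\sqsupseteq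 p$; $p\approx q$ means $p\sqsupseteq q$ and $q\sqsupseteq p$. The same symbols are used for atoms, referring to their predicates. Level mappings. Let $\mathbf B_P^{Inp}$ be the set of atoms using predicates occurring in $P$ that are correctly typed in their input positions. A function $|.|:\mathbf B_P^{Inp}\to\mathbb N$ is a moded typed level mapping if for each $p(\mathbf s,\mathbf t)\in\mathbf B_P^{Inp}$: $|p(\mathbf s,\mathbf t)|=|p(\mathbf s,\mathbf u)|$ for any $\mathbf u$, and $|p(\mathbf s,\mathbf t)|=|p(\mathbf s\theta,\mathbf t)|$ for any substitution $\theta$. Well-recurrent. A clause $h\leftarrow B$ is well-recurrent with respect to $|.|$ if for every $a$ in $B$ with $a\approx h$ and every substitution $\theta$ such that $a\theta,h\theta\in\mathbf B_P^{Inp}$, we have $|h\theta|>|a\theta|$. -}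

module Defs where

open import Level using (0ℓ)
open import Data.Empty using (⊥)
open import Data.Fin.Base using (Fin)
open import Data.List.Base using (List; []; _∷_; [_]; _++_; concatMap; map)
open import Data.List.Membership.Propositional using () renaming (_∈_ to _∈ₗ_)
open import Data.List.Relation.Binary.Disjoint.Propositional using (Disjoint)
open import Data.List.Relation.Unary.All using (All)
open import Data.List.Relation.Unary.Any using (Any)
open import Data.List.Relation.Unary.Unique.Propositional using (Unique)
open import Data.Nat.Base using (ℕ; zero; suc; _+_; _>_)
open import Data.Product.Base using (_×_; _,_; Σ-syntax; ∃-syntax)
open import Data.Sum.Base using (_⊎_)
open import Data.Unit.Base using (⊤)
open import Data.Vec.Base as Vec using (Vec; []; _∷_; lookup; toList)
open import Relation.Binary.Construct.Closure.ReflexiveTransitive using (Star; ε; _◅_)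
open import Relation.Binary.PropositionalEquality.Core using (_≡_)
open import Relation.Nullary.Negation.Core using (¬_)
open import Relation.Unary using (Satisfiable; Universal; _≐_; _∈_) renaming (Pred to Subset)

-- The argument positions of a predicate are grouped by mode: `inArity p` input
-- positions and `outArity p` output positions.  Their interleaving in a
-- concrete syntax plays no role.
record Signature : Set₁ where
  field
    Fun             : Set
    arity           : Fun → ℕ
    Pred            : Set
    inArity         : Pred → ℕ
    outArity        : Pred → ℕ
    equality        : Pred
    equality-binary : inArity equality + outArity equality ≡ 2

module Syntax (S : Signature) where
  open Signature S public

  Var : Set
  Var = ℕ

  data Term : Set where
    var : Var → Term
    app : (f : Fun) → Vec Term (arity f) → Term

  -- Variables are listed with multiplicity, so linearity is `Unique`.
  vars  : Term → List Var
  varsᵛ : ∀ {n} → Vec Term n → List Var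
  vars (var x)    = [ x ]
  vars (app f ts) = varsᵛ ts
  varsᵛ []       = []
  varsᵛ (t ∷ ts) = vars t ++ varsᵛ ts

  Subst : Set
  Subst = Var → Term

  infixl 8 _[_]ᵗ _[_]ᵛ _[_]ᵃ _[_]ᵠ _[_]ᶜ

  _[_]ᵗ : Term → Subst → Term
  _[_]ᵛ : ∀ {n} → Vec Term n → Subst → Vec Term n
  var x    [ σ ]ᵗ = σ x
  app f ts [ σ ]ᵗ = app f (ts [ σ ]ᵛ)
  []       [ σ ]ᵛ = []
  (t ∷ ts) [ σ ]ᵛ = t [ σ ]ᵗ ∷ ts [ σ ]ᵛ

  IsVar : Term → Set
  IsVar t = ∃[ x ] t ≡ var x

  data Flat : Term → Set where
    flat-var : ∀ x → Flat (var x)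
    flat-app : ∀ f (xs : Vec Var (arity f)) → Unique (toList xs) →
               Flat (app f (Vec.map var xs))

  record Atom : Set where
    constructor atom
    field
      pred : Pred
      ins  : Vec Term (inArity pred)
      outs : Vec Term (outArity pred)
  open Atom public

  Query : Set
  Query = List Atom

  infix 5 _⟵_

  record Clause : Set where
    constructor _⟵_
    field
      head : Atom
      body : Query
  open Clause public

  inVars outVars varsᵃ : Atom → List Var
  inVars  a = varsᵛ (ins a)
  outVars a = varsᵛ (outs a)
  varsᵃ   a = inVars a ++ outVars a

  varsᵠ : Query → List Var
  varsᵠ = concatMap varsᵃ

  varsᶜ : Clause → List Var
  varsᶜ (h ⟵ B) = varsᵠ (h ∷ B)

  _[_]ᵃ : Atom → Subst → Atom
  atom p s t [ σ ]ᵃ = atom p (s [ σ ]ᵛ) (t [ σ ]ᵛ)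

  _[_]ᵠ : Query → Subst → Query
  Q [ σ ]ᵠ = map (_[ σ ]ᵃ) Q

  _[_]ᶜ : Clause → Subst → Clause
  (h ⟵ B) [ σ ]ᶜ = (h [ σ ]ᵃ) ⟵ (B [ σ ]ᵠ)

  data Mark : Set where
    qmark dash : Mark

  record BlockAtom (p : Pred) : Set where
    field
      inMarks  : Vec Mark (inArity p)
      outMarks : Vec Mark (outArity p)
  open BlockAtom public

  record Program : Set where
    field
      clauses : List Clause
      block   : ∀ p → List (BlockAtom p)
  open Program public

  OccursIn : Pred → Program → Set
  OccursIn p P = Any (λ c → Any (λ a → pred a ≡ p) (head c ∷ body c)) (clauses P)

  InputLinearClause : Clause → Set
  InputLinearClause c = Unique (inVars (head c))

  InputLinear : Program → Set
  InputLinear P =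
    All InputLinearClause (clauses P) ×
    ¬ (OccursIn equality P × inArity equality ≡ 2)

  NicelyModed : Query → Set
  NicelyModed Q =
    Unique (concatMap outVars Q) ×
    (∀ Q₁ a Q₂ → Q ≡ Q₁ ++ a ∷ Q₂ → Disjoint (inVars a) (concatMap outVars (a ∷ Q₂)))

  NicelyModedClause : Clause → Set
  NicelyModedClause (h ⟵ B) =
    NicelyModed B × Disjoint (inVars h) (concatMap outVars B)

  BoundIn : Program → (p : Pred) → Fin (inArity p) → Set
  BoundIn P p i =
    ∃[ s ] ∃[ t ] ∃[ B ] ((atom p s t ⟵ B) ∈ₗ clauses P × ¬ IsVar (lookup s i))

  BoundOut : Program → (p : Pred) → Fin (outArity p) → Set
  BoundOut P p i =
    ∃[ c ] ∃[ s ] ∃[ t ]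
      (c ∈ₗ clauses P × atom p s t ∈ₗ body c × ¬ IsVar (lookup t i))

  FreeIn : Program → (p : Pred) → Fin (inArity p) → Set
  FreeIn P p i = ¬ BoundIn P p i

  FreeOut : Program → (p : Pred) → Fin (outArity p) → Set
  FreeOut P p i = ¬ BoundOut P p i

  Blocks : (a : Atom) → BlockAtom (pred a) → Set
  Blocks a b =
    (∀ i → lookup (inMarks b) i ≡ dash → IsVar (lookup (ins a) i)) ×
    (∀ i → lookup (outMarks b) i ≡ dash → IsVar (lookup (outs a) i))

  Blocked : Program → Atom → Set
  Blocked P a = Any (Blocks a) (block P (pred a))

  Selectable : Program → Atom → Set
  Selectable P a = ¬ Blocked P a

  Unifier : Atom → Atom → Subst → Set
  Unifier a b θ = a [ θ ]ᵃ ≡ b [ θ ]ᵃ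

  MGU : Atom → Atom → Subst → Set
  MGU a b θ =
    Unifier a b θ ×
    (∀ η → Unifier a b η → ∃[ γ ] (∀ x → η x ≡ θ x [ γ ]ᵗ))

  Variant : Clause → Clause → Set
  Variant c d = (∃[ ρ ] d ≡ c [ ρ ]ᶜ) × (∃[ ρ ] c ≡ d [ ρ ]ᶜ)

  record Step (P : Program) (Q Q′ : Query) : Set where
    field
      before   : Query
      selected : Atom
      after    : Query
      split    : Q ≡ before ++ selected ∷ after
      clause   : Clause
      clause∈P : clause ∈ₗ clauses P
      renamed  : Clause
      variant  : Variant clause renamed
      apart    : Disjoint (varsᶜ renamed) (varsᵠ Q)
      θ        : Subst
      mgu      : MGU selected (head renamed) θ
      result   : Q′ ≡ (before ++ body renamed ++ after) [ θ ]ᵠ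
  open Step public using (selected)

  data Derivation (P : Program) (Q : Query) : Set where
    finite   : ∀ {Q′} → Star (Step P) Q Q′ → Derivation P Q
    infinite : (Qs : ℕ → Query) → Qs zero ≡ Q →
               (∀ n → Step P (Qs n) (Qs (suc n))) → Derivation P Q

  Finite : ∀ {P Q} → Derivation P Q → Set
  Finite (finite _)       = ⊤
  Finite (infinite _ _ _) = ⊥

  AllSelectable : ∀ {P Q Q′} → Star (Step P) Q Q′ → Set
  AllSelectable     ε        = ⊤
  AllSelectable {P} (s ◅ ss) = Selectable P (selected s) × AllSelectable ss

  DelayRespecting : ∀ {P Q} → Derivation P Q → Set
  DelayRespecting     (finite ss)          = AllSelectable ss
  DelayRespecting {P} (infinite _ _ steps) = ∀ n → Selectable P (selected (steps n))

  RefersTo : Program → Pred → Pred → Set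
  RefersTo P p q =
    Any (λ c → pred (head c) ≡ p × Any (λ a → pred a ≡ q) (body c)) (clauses P)

  infix 4 _⊢_⊒_ _⊢_⊐_ _⊢_≈_

  _⊢_⊒_ _⊢_⊐_ _⊢_≈_ : Program → Pred → Pred → Set
  P ⊢ p ⊒ q = Star (RefersTo P) p q
  P ⊢ p ⊐ q = P ⊢ p ⊒ q × ¬ (P ⊢ q ⊒ p)
  P ⊢ p ≈ q = P ⊢ p ⊒ q × P ⊢ q ⊒ p

  record Type : Set₁ where
    field
      ⟦_⟧      : Subset Term 0ℓ
      nonEmpty : Satisfiable ⟦_⟧
      closed   : ∀ {t} (σ : Subst) → t ∈ ⟦_⟧ → t [ σ ]ᵗ ∈ ⟦_⟧
  open Type public using (⟦_⟧)

  NonVariableType : Type → Set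
  NonVariableType T = ¬ Universal ⟦ T ⟧

  -- Types are sets of terms, so equality of types is extensional.
  SameType : Type → Type → Set
  SameType T U = ⟦ T ⟧ ≐ ⟦ U ⟧

  TypeConsistent : Type → Term → Set
  TypeConsistent T t = ∃[ σ ] t [ σ ]ᵗ ∈ ⟦ T ⟧

  record Typing : Set₁ where
    field
      inType  : (p : Pred) → Fin (inArity p) → Type
      outType : (p : Pred) → Fin (outArity p) → Type

module Typed (S : Signature) (τ : Syntax.Typing S) where
  open Syntax S
  open Typing τ

  InTyped OutTyped : Atom → Set
  InTyped  a = ∀ i → lookup (ins a) i ∈ ⟦ inType (pred a) i ⟧
  OutTyped a = ∀ i → lookup (outs a) i ∈ ⟦ outType (pred a) i ⟧

  WellTyped : Query → Set
  WellTyped Q =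
    ∀ Q₁ a Q₂ → Q ≡ Q₁ ++ a ∷ Q₂ →
    ∀ σ → All OutTyped (Q₁ [ σ ]ᵠ) → InTyped (a [ σ ]ᵃ)

  WellTypedClause : Clause → Set
  WellTypedClause (h ⟵ B) =
    (∀ B₁ a B₂ → B ≡ B₁ ++ a ∷ B₂ →
     ∀ σ → InTyped (h [ σ ]ᵃ) → All OutTyped (B₁ [ σ ]ᵠ) → InTyped (a [ σ ]ᵃ)) ×
    (∀ σ → InTyped (h [ σ ]ᵃ) → All OutTyped (B [ σ ]ᵠ) → OutTyped (h [ σ ]ᵃ))

  BoundNonVariable : Program → Set
  BoundNonVariable P =
    (∀ p i → BoundIn P p i → NonVariableType (inType p i)) ×
    (∀ p i → BoundOut P p i → NonVariableType (outType p i))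

  RobustIns : Program → Atom → Set
  RobustIns P a =
    (∀ i → FreeIn P (pred a) i → IsVar (lookup (ins a) i)) ×
    (∀ i → BoundIn P (pred a) i →
      Flat (lookup (ins a) i) × TypeConsistent (inType (pred a) i) (lookup (ins a) i))

  RobustOuts : Program → Atom → Set
  RobustOuts P a =
    (∀ i → FreeOut P (pred a) i → IsVar (lookup (outs a) i)) ×
    (∀ i → BoundOut P (pred a) i →
      Flat (lookup (outs a) i) × TypeConsistent (outType (pred a) i) (lookup (outs a) i))

  RobustlyTyped : Program → Query → Set
  RobustlyTyped P Q = NicelyModed Q × WellTyped Q × All (RobustOuts P) Q

  FillsBoundIn : Program → Type → Var → Atom → Set
  FillsBoundIn P T x a =
    ∃[ j ] (BoundIn P (pred a) j × SameType (inType (pred a) j) T × lookup (ins a) j ≡ var x)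

  FillsBoundOut : Program → Type → Var → Atom → Set
  FillsBoundOut P T x a =
    ∃[ j ] (BoundOut P (pred a) j × SameType (outType (pred a) j) T × lookup (outs a) j ≡ var x)

  RobustlyTypedClause : Program → Clause → Set
  RobustlyTypedClause P (h ⟵ B) =
    NicelyModedClause (h ⟵ B) ×
    WellTypedClause (h ⟵ B) ×
    RobustIns P h ×
    All (RobustOuts P) B ×
    (∀ i x → BoundOut P (pred h) i → lookup (outs h) i ≡ var x →
      FillsBoundIn P (outType (pred h) i) x h ⊎
      Any (FillsBoundOut P (outType (pred h) i) x) B)

  RobustlyTypedProgram : Program → Set
  RobustlyTypedProgram P =
    BoundNonVariable P × All (RobustlyTypedClause P) (clauses P)

  InputSelectability : Program → Set
  InputSelectability P =
    ∀ a → OccursIn (pred a) P →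
    (∀ i → FreeOut P (pred a) i → IsVar (lookup (outs a) i)) →
    (Selectable P a → ∀ i → BoundIn P (pred a) i → ¬ IsVar (lookup (ins a) i)) ×
    ((∀ i → NonVariableType (inType (pred a) i) → ¬ IsVar (lookup (ins a) i)) →
     Selectable P a)

  Robust : Program → Pred → Set
  Robust P p =
    ∀ s t → RobustlyTyped P [ atom p s t ] →
    (d : Derivation P [ atom p s t ]) → DelayRespecting d → Finite d

  𝐁ᴵⁿᵖ : Program → Subset Atom 0ℓ
  𝐁ᴵⁿᵖ P a = OccursIn (pred a) P × InTyped a

  -- `out-invariant` with u = t also makes the level independent of the
  -- membership proof, so `level` is a function on the set 𝐁ᴵⁿᵖ P.
  record ModedTypedLevelMapping (P : Program) : Set where
    field
      level : ∀ a → a ∈ 𝐁ᴵⁿᵖ P → ℕ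
      out-invariant :
        ∀ {p s t u} (m : atom p s t ∈ 𝐁ᴵⁿᵖ P) (m′ : atom p s u ∈ 𝐁ᴵⁿᵖ P) →
        level (atom p s t) m ≡ level (atom p s u) m′
      subst-invariant :
        ∀ {p s t} θ (m : atom p s t ∈ 𝐁ᴵⁿᵖ P) (m′ : atom p (s [ θ ]ᵛ) t ∈ 𝐁ᴵⁿᵖ P) →
        level (atom p s t) m ≡ level (atom p (s [ θ ]ᵛ) t) m′

  WellRecurrent : (P : Program) → ModedTypedLevelMapping P → Clause → Set
  WellRecurrent P ∣·∣ (h ⟵ B) =
    ∀ a → a ∈ₗ B → P ⊢ pred a ≈ pred h →
    ∀ θ (ma : (a [ θ ]ᵃ) ∈ 𝐁ᴵⁿᵖ P) (mh : (h [ θ ]ᵃ) ∈ 𝐁ᴵⁿᵖ P) →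
    level (h [ θ ]ᵃ) mh > level (a [ θ ]ᵃ) ma
    where open ModedTypedLevelMapping ∣·∣

module Submission where

open import Level using (0ℓ)
open import Axiom.ExcludedMiddle using (ExcludedMiddle)
open import Axiom.DoubleNegationElimination using (em⇒dne)
open import Data.Empty using (⊥-elim)
open import Data.Fin.Base using (Fin; zero; suc)
open import Data.List.Base using (List; []; _∷_; [_]; _++_; concatMap; map)
open import Data.List.Extrema.Nat using (max; xs≤max)
open import Data.List.Membership.Propositional using (find) renaming (_∈_ to _∈ₗ_; _∉_ to _∉ₗ_)
open import Data.List.Membership.Propositional.Properties using (∈-++⁺ˡ; ∈-++⁺ʳ; ∈-++⁻; ∈-map⁺; ∈-map⁻; ∈-concatMap⁺; ∈-concatMap⁻)
open import Data.List.Properties using (concatMap-++; map-++; ++-assoc; ++-identityʳ; ∷-injective)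
open import Data.List.Relation.Binary.Disjoint.Propositional using (Disjoint)
open import Data.List.Relation.Binary.Subset.Propositional using (_⊆_)
open import Data.List.Relation.Unary.All as All using (All; []; _∷_)
import Data.List.Relation.Unary.All.Properties as All
open import Data.List.Relation.Unary.Any as Any using (Any; here; there)
import Data.List.Relation.Unary.Any.Properties as Any
open import Data.List.Relation.Unary.AllPairs using ([]; _∷_)
open import Data.List.Relation.Unary.Unique.Propositional using (Unique)
import Data.List.Relation.Unary.Unique.Propositional.Properties as Unique
open import Data.Nat.Base using (ℕ; zero; suc; _+_; _∸_; _≤_; _<_; _⊔_; s≤s)
open import Data.Nat.Properties using (_≟_; m≤m+n; m+n∸m≡n; +-cancelˡ-≡; ≤-refl; ≤-trans; <-≤-trans; <⇒≱; m≤m⊔n; m≤n⊔m)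
open import Data.List.Membership.DecPropositional _≟_ using (_∈?_)
open import Data.Product.Base using (Σ-syntax; ∃-syntax; _×_; _,_; proj₁; proj₂)
open import Data.Sum.Base as Sum using (_⊎_; inj₁; inj₂)
open import Data.Unit.Base using (⊤; tt)
open import Data.Vec.Base as Vec using (Vec; []; _∷_; lookup; toList)
open import Function.Base using (_∘_; case_of_)
open import Induction.WellFounded using (Acc; acc)
open import Relation.Binary.Construct.Closure.ReflexiveTransitive using (ε; _◅_; _◅◅_)
open import Relation.Binary.PropositionalEquality using (_≡_; _≢_; refl; sym; trans; cong; cong₂; subst; subst₂)
open import Relation.Nullary using (¬_; Dec; yes; no)
open import Relation.Nullary.Negation using (contradiction)
open import Relation.Unary using (_∈_)
open import Defs

-- By input selectability a resolution step only matches the input terms of the selected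
-- atom against the clause head, so a step in one part of a query affects later atoms
-- only through the output variables of that part, and earlier atoms not at all.  Hence a
-- computation of F , G can be replayed on G alone: if F has finitely many steps left,
-- choose an instance in which the outputs of F are correctly typed, apply it to G in
-- advance, and let this more instantiated copy of G follow the steps of G.  So F , G
-- terminates if F does and the copies of G do.  In the resolvent of p(s , t) by a clause,
-- this is used to add one body atom at a time.  The copy of a body atom is correctly
-- typed in its input positions, so it is robust by assumption or has a smaller level
-- than p(s , t).

-- The obstacle is interleaving: `F` may instantiate the inputs of `G` at any moment, after `G` has
-- already moved on partial inputs, so no single run of `G` bounds its steps in advance. What is
-- maintained is a family of promises: for every substitution under which the outputs of `F` are
-- correctly typed, some terminating copy of `G`. A step of `F` pulls these substitutions back along
-- its mgu and leaves the promised copies unchanged; a step of `G` advances every copy by one step.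
-- Termination is then a lexicographic induction on `F` and one selected copy. The substitution
-- selected need not be an answer that `F` ever computes.
--
-- A copy may rename the output variables of `G` but not instantiate them, since a function symbol
-- put there could clash with the clause head. Derivations use arbitrary mgus, so a canonical one is
-- constructed, and the simulation that compares copies also carries arbitrary derivations over to
-- canonical ones. Excluded middle decides whether a position is bound and converts the absence of
-- infinite derivations into accessibility.

-- Lists without repetitions.

module _ {A : Set} where

  Unique-++⁻ : ∀ (xs : List A) {ys} → Unique (xs ++ ys) →
               Unique xs × Unique ys × Disjoint xs ys
  Unique-++⁻ []       u        = [] , u , λ ()
  Unique-++⁻ (x ∷ xs) (x∉ ∷ u) with Unique-++⁻ xs u
  ... | u₁ , u₂ , d = All.++⁻ˡ xs x∉ ∷ u₁ , u₂ , λ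
    { (here refl , q) → All.lookup (All.++⁻ʳ xs x∉) q refl
    ; (there p   , q) → d (p , q) }

  -- This is what resolution does to the output variables of a query: those of the selected atom
  -- give way to variables that come either from that atom or from a clause renamed apart.
  Unique-splice : ∀ (xs : List A) {ys ys′ zs} → Unique (xs ++ ys ++ zs) → Unique ys′ →
                  (∀ {w} → w ∈ₗ ys′ → w ∈ₗ ys ⊎ (w ∉ₗ xs × w ∉ₗ zs)) →
                  Unique (xs ++ ys′ ++ zs)
  Unique-splice xs {ys} {ys′} u u′ new with Unique-++⁻ xs u
  ... | u₁ , u₂ , d₁ with Unique-++⁻ ys u₂
  ... | _ , u₃ , d₂ = Unique.++⁺ u₁ (Unique.++⁺ u′ u₃ d₃) d₄
    where
    d₃ : Disjoint ys′ _
    d₃ (p , q) with new p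
    ... | inj₁ r       = d₂ (r , q)
    ... | inj₂ (_ , n) = n q
    d₄ : Disjoint xs _
    d₄ (p , q) with ∈-++⁻ ys′ q
    ... | inj₂ r = d₁ (p , ∈-++⁺ʳ ys r)
    ... | inj₁ r with new r
    ... | inj₁ r′      = d₁ (p , ∈-++⁺ˡ r′)
    ... | inj₂ (n , _) = n p

  split-++ : ∀ (xs : List A) {ys us z vs} → xs ++ ys ≡ us ++ z ∷ vs →
             (∃[ ws ] (xs ≡ us ++ z ∷ ws × vs ≡ ws ++ ys)) ⊎
             (∃[ ws ] (us ≡ xs ++ ws × ys ≡ ws ++ z ∷ vs))
  split-++ []       {us = us}     eq = inj₂ (us , refl , eq)
  split-++ (x ∷ xs) {us = []}     refl = inj₁ (xs , refl , refl)
  split-++ (x ∷ xs) {us = u ∷ us} eq with ∷-injective eq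
  ... | refl , eq′ with split-++ xs {us = us} eq′
  ... | inj₁ (ws , p , q) = inj₁ (ws , cong (x ∷_) p , q)
  ... | inj₂ (ws , p , q) = inj₂ (ws , cong (x ∷_) p , q)

module _ {A B : Set} {f : A → List B} where

  ∈-concatMap-∃ : ∀ {xs y} → y ∈ₗ concatMap f xs → ∃[ x ] (x ∈ₗ xs × y ∈ₗ f x)
  ∈-concatMap-∃ p = find (∈-concatMap⁻ f p)

  ∈-concatMap-intro : ∀ {xs x y} → x ∈ₗ xs → y ∈ₗ f x → y ∈ₗ concatMap f xs
  ∈-concatMap-intro p q = ∈-concatMap⁺ f (Any.map (λ { refl → q }) p)

  Unique-concatMap⁺ : ∀ {xs} → Unique xs → (∀ {x} → x ∈ₗ xs → Unique (f x)) →
                      (∀ {x y} → x ∈ₗ xs → y ∈ₗ xs → x ≢ y → Disjoint (f x) (f y)) →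
                      Unique (concatMap f xs)
  Unique-concatMap⁺ {[]}     _        _ _ = []
  Unique-concatMap⁺ {x ∷ xs} (x∉ ∷ u) v d =
    Unique.++⁺ (v (here refl))
      (Unique-concatMap⁺ u (v ∘ there) (λ p q → d (there p) (there q)))
      λ (p , q) → let (z , z∈ , q′) = ∈-concatMap-∃ q in
        d (here refl) (there z∈) (All.lookup x∉ z∈) (p , q′)

  -- A repeated entry would contribute the same element twice, provided that it contributes one at
  -- all.
  Unique-concatMap⁻ : ∀ {xs} → (∀ {x} → x ∈ₗ xs → ∃[ y ] y ∈ₗ f x) →
                      Unique (concatMap f xs) → Unique xs
  Unique-concatMap⁻ {[]}     _ _ = []
  Unique-concatMap⁻ {x ∷ xs} h u with Unique-++⁻ (f x) u
  ... | _ , u₂ , d =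
    All.tabulate (λ { p refl → d (proj₂ (h (here refl)) , ∈-concatMap-intro p (proj₂ (h (here refl)))) })
    ∷ Unique-concatMap⁻ (h ∘ there) u₂

-- Substitutions and matching of linear vectors of flat terms.

module Substitutions (S : Signature) where
  open Syntax S

  infixl 9 _⨟_
  _⨟_ : Subst → Subst → Subst
  (σ ⨟ δ) x = σ x [ δ ]ᵗ

  AgreeOn : List Var → Subst → Subst → Set
  AgreeOn xs σ δ = ∀ {x} → x ∈ₗ xs → σ x ≡ δ x

  _[_]ˡ : List Var → Subst → List Var
  xs [ σ ]ˡ = concatMap (vars ∘ σ) xs

  outVarsᵠ : Query → List Var
  outVarsᵠ = concatMap outVars

  ⨟-termᵗ : ∀ t {σ δ} → t [ σ ]ᵗ [ δ ]ᵗ ≡ t [ σ ⨟ δ ]ᵗ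
  ⨟-termᵛ : ∀ {n} (ts : Vec Term n) {σ δ} → ts [ σ ]ᵛ [ δ ]ᵛ ≡ ts [ σ ⨟ δ ]ᵛ
  ⨟-termᵗ (var x)    = refl
  ⨟-termᵗ (app f ts) = cong (app f) (⨟-termᵛ ts)
  ⨟-termᵛ []         = refl
  ⨟-termᵛ (t ∷ ts)   = cong₂ _∷_ (⨟-termᵗ t) (⨟-termᵛ ts)

  ⨟-termᵃ : ∀ a {σ δ} → a [ σ ]ᵃ [ δ ]ᵃ ≡ a [ σ ⨟ δ ]ᵃ
  ⨟-termᵃ (atom p s t) = cong₂ (atom p) (⨟-termᵛ s) (⨟-termᵛ t)

  ⨟-termᵠ : ∀ Q {σ δ} → Q [ σ ]ᵠ [ δ ]ᵠ ≡ Q [ σ ⨟ δ ]ᵠ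
  ⨟-termᵠ []      = refl
  ⨟-termᵠ (a ∷ Q) = cong₂ _∷_ (⨟-termᵃ a) (⨟-termᵠ Q)

  []-congᵗ : ∀ t {σ δ} → AgreeOn (vars t) σ δ → t [ σ ]ᵗ ≡ t [ δ ]ᵗ
  []-congᵛ : ∀ {n} (ts : Vec Term n) {σ δ} → AgreeOn (varsᵛ ts) σ δ → ts [ σ ]ᵛ ≡ ts [ δ ]ᵛ
  []-congᵗ (var x)    h = h (here refl)
  []-congᵗ (app f ts) h = cong (app f) ([]-congᵛ ts h)
  []-congᵛ []         h = refl
  []-congᵛ (t ∷ ts)   h =
    cong₂ _∷_ ([]-congᵗ t (h ∘ ∈-++⁺ˡ)) ([]-congᵛ ts (h ∘ ∈-++⁺ʳ (vars t)))

  []-congᵃ : ∀ a {σ δ} → AgreeOn (varsᵃ a) σ δ → a [ σ ]ᵃ ≡ a [ δ ]ᵃ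
  []-congᵃ (atom p s t) h =
    cong₂ (atom p) ([]-congᵛ s (h ∘ ∈-++⁺ˡ)) ([]-congᵛ t (h ∘ ∈-++⁺ʳ (varsᵛ s)))

  []-congᵠ : ∀ Q {σ δ} → AgreeOn (varsᵠ Q) σ δ → Q [ σ ]ᵠ ≡ Q [ δ ]ᵠ
  []-congᵠ []      h = refl
  []-congᵠ (a ∷ Q) h =
    cong₂ _∷_ ([]-congᵃ a (h ∘ ∈-++⁺ˡ)) ([]-congᵠ Q (h ∘ ∈-++⁺ʳ (varsᵃ a)))

  var-injective : ∀ {x y} → var x ≡ var y → x ≡ y
  var-injective refl = refl

  app-injective : ∀ {f ts us} → app f ts ≡ app f us → ts ≡ us
  app-injective refl = refl

  ∷ᵛ-injective : ∀ {A : Set} {n} {x y : A} {xs ys : Vec A n} → x ∷ xs ≡ y ∷ ys → x ≡ y × xs ≡ ys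
  ∷ᵛ-injective refl = refl , refl

  atom-injective : ∀ {p s t u v} → atom p s t ≡ atom p u v → s ≡ u × t ≡ v
  atom-injective refl = refl , refl

  []-injᵗ : ∀ t {σ δ} → t [ σ ]ᵗ ≡ t [ δ ]ᵗ → AgreeOn (vars t) σ δ
  []-injᵛ : ∀ {n} (ts : Vec Term n) {σ δ} → ts [ σ ]ᵛ ≡ ts [ δ ]ᵛ → AgreeOn (varsᵛ ts) σ δ
  []-injᵗ (var x)    eq (here refl) = eq
  []-injᵗ (app f ts) eq p = []-injᵛ ts (app-injective eq) p
  []-injᵛ (t ∷ ts) eq p with ∈-++⁻ (vars t) p
  ... | inj₁ q = []-injᵗ t (proj₁ (∷ᵛ-injective eq)) q
  ... | inj₂ q = []-injᵛ ts (proj₂ (∷ᵛ-injective eq)) q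

  []-injᵃ : ∀ a {σ δ} → a [ σ ]ᵃ ≡ a [ δ ]ᵃ → AgreeOn (varsᵃ a) σ δ
  []-injᵃ (atom p s t) eq q with ∈-++⁻ (varsᵛ s) q
  ... | inj₁ r = []-injᵛ s (proj₁ (atom-injective eq)) r
  ... | inj₂ r = []-injᵛ t (proj₂ (atom-injective eq)) r

  []-injᵠ : ∀ Q {σ δ} → Q [ σ ]ᵠ ≡ Q [ δ ]ᵠ → AgreeOn (varsᵠ Q) σ δ
  []-injᵠ (a ∷ Q) eq q with ∈-++⁻ (varsᵃ a) q
  ... | inj₁ r = []-injᵃ a (proj₁ (∷-injective eq)) r
  ... | inj₂ r = []-injᵠ Q (proj₂ (∷-injective eq)) r

  []-idᵗ : ∀ t → t [ var ]ᵗ ≡ t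
  []-idᵛ : ∀ {n} (ts : Vec Term n) → ts [ var ]ᵛ ≡ ts
  []-idᵗ (var x)    = refl
  []-idᵗ (app f ts) = cong (app f) ([]-idᵛ ts)
  []-idᵛ []         = refl
  []-idᵛ (t ∷ ts)   = cong₂ _∷_ ([]-idᵗ t) ([]-idᵛ ts)

  []-idᵃ : ∀ a → a [ var ]ᵃ ≡ a
  []-idᵃ (atom p s t) = cong₂ (atom p) ([]-idᵛ s) ([]-idᵛ t)

  []-idᵠ : ∀ Q → Q [ var ]ᵠ ≡ Q
  []-idᵠ []      = refl
  []-idᵠ (a ∷ Q) = cong₂ _∷_ ([]-idᵃ a) ([]-idᵠ Q)

  lookup-[] : ∀ {n} (ts : Vec Term n) σ i → lookup (ts [ σ ]ᵛ) i ≡ lookup ts i [ σ ]ᵗ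
  lookup-[] (t ∷ ts) σ zero    = refl
  lookup-[] (t ∷ ts) σ (suc i) = lookup-[] ts σ i

  vars-[]ᵗ : ∀ t σ → vars (t [ σ ]ᵗ) ≡ vars t [ σ ]ˡ
  vars-[]ᵛ : ∀ {n} (ts : Vec Term n) σ → varsᵛ (ts [ σ ]ᵛ) ≡ varsᵛ ts [ σ ]ˡ
  vars-[]ᵗ (var x)    σ = sym (++-identityʳ (vars (σ x)))
  vars-[]ᵗ (app f ts) σ = vars-[]ᵛ ts σ
  vars-[]ᵛ []         σ = refl
  vars-[]ᵛ (t ∷ ts)   σ =
    trans (cong₂ _++_ (vars-[]ᵗ t σ) (vars-[]ᵛ ts σ))
          (sym (concatMap-++ (vars ∘ σ) (vars t) (varsᵛ ts)))

  vars-[]ᵃ : ∀ a σ → varsᵃ (a [ σ ]ᵃ) ≡ varsᵃ a [ σ ]ˡ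
  vars-[]ᵃ a@(atom _ s t) σ =
    trans (cong₂ _++_ (vars-[]ᵛ s σ) (vars-[]ᵛ t σ))
          (sym (concatMap-++ (vars ∘ σ) (inVars a) (outVars a)))

  vars-[]ᵠ : ∀ Q σ → varsᵠ (Q [ σ ]ᵠ) ≡ varsᵠ Q [ σ ]ˡ
  vars-[]ᵠ []      σ = refl
  vars-[]ᵠ (a ∷ Q) σ =
    trans (cong₂ _++_ (vars-[]ᵃ a σ) (vars-[]ᵠ Q σ))
          (sym (concatMap-++ (vars ∘ σ) (varsᵃ a) (varsᵠ Q)))

  outVars-[]ᵠ : ∀ Q σ → outVarsᵠ (Q [ σ ]ᵠ) ≡ outVarsᵠ Q [ σ ]ˡ
  outVars-[]ᵠ []      σ = refl
  outVars-[]ᵠ (a ∷ Q) σ =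
    trans (cong₂ _++_ (vars-[]ᵛ (outs a) σ) (outVars-[]ᵠ Q σ))
          (sym (concatMap-++ (vars ∘ σ) (outVars a) (outVarsᵠ Q)))

  ∈-[]ˡ⁻ : ∀ σ {xs ys y} → ys ≡ xs [ σ ]ˡ → y ∈ₗ ys → ∃[ x ] (x ∈ₗ xs × y ∈ₗ vars (σ x))
  ∈-[]ˡ⁻ _ refl = ∈-concatMap-∃

  ∈-[]ˡ⁺ : ∀ σ {xs ys x y} → ys ≡ xs [ σ ]ˡ → x ∈ₗ xs → y ∈ₗ vars (σ x) → y ∈ₗ ys
  ∈-[]ˡ⁺ _ refl = ∈-concatMap-intro

  vars-≡ : ∀ t {u} → t ≡ u → vars t ⊆ vars u
  vars-≡ t refl p = p

  lookup-⊆ : ∀ {n} (ts : Vec Term n) i → vars (lookup ts i) ⊆ varsᵛ ts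
  lookup-⊆ (t ∷ ts) zero    p = ∈-++⁺ˡ p
  lookup-⊆ (t ∷ ts) (suc i) p = ∈-++⁺ʳ (vars t) (lookup-⊆ ts i p)

  ∈-lookup : ∀ {n} (ts : Vec Term n) {x} → x ∈ₗ varsᵛ ts → ∃[ i ] x ∈ₗ vars (lookup ts i)
  ∈-lookup (t ∷ ts) p with ∈-++⁻ (vars t) p
  ... | inj₁ q = zero , q
  ... | inj₂ q = let (i , r) = ∈-lookup ts q in suc i , r

  lookup-varᵛ : ∀ {n} (ts : Vec Term n) i {x} → lookup ts i ≡ var x → x ∈ₗ varsᵛ ts
  lookup-varᵛ ts i eq = lookup-⊆ ts i (subst (λ t → _ ∈ₗ vars t) (sym eq) (here refl))

  Unique-lookup : ∀ {n} (ts : Vec Term n) i → Unique (varsᵛ ts) → Unique (vars (lookup ts i))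
  Unique-lookup (t ∷ ts) zero    u = proj₁ (Unique-++⁻ (vars t) u)
  Unique-lookup (t ∷ ts) (suc i) u = Unique-lookup ts i (proj₁ (proj₂ (Unique-++⁻ (vars t) u)))

  same-position : ∀ {n} (ts : Vec Term n) {i j x} → Unique (varsᵛ ts) →
                  x ∈ₗ vars (lookup ts i) → x ∈ₗ vars (lookup ts j) → i ≡ j
  same-position (t ∷ ts) {zero}  {zero}  u p q = refl
  same-position (t ∷ ts) {zero}  {suc j} u p q =
    ⊥-elim (proj₂ (proj₂ (Unique-++⁻ (vars t) u)) (p , lookup-⊆ ts j q))
  same-position (t ∷ ts) {suc i} {zero}  u p q =
    ⊥-elim (proj₂ (proj₂ (Unique-++⁻ (vars t) u)) (q , lookup-⊆ ts i p))
  same-position (t ∷ ts) {suc i} {suc j} u p q =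
    cong suc (same-position ts (proj₁ (proj₂ (Unique-++⁻ (vars t) u))) p q)

  OutPosition : Set
  OutPosition = Σ[ a ∈ Atom ] Fin (outArity (pred a))

  -- The equation is between pairs because the index type of a position depends on its atom;
  -- matching on it identifies atom and position together.
  same-out-position : ∀ {Q a b} {i : Fin (outArity (pred a))} {j : Fin (outArity (pred b))} {x} →
    Unique (outVarsᵠ Q) → a ∈ₗ Q → b ∈ₗ Q →
    x ∈ₗ vars (lookup (outs a) i) → x ∈ₗ vars (lookup (outs b) j) →
    _≡_ {A = OutPosition} (a , i) (b , j)
  same-out-position {c ∷ Q} {i = i} {j} u a∈ b∈ p q with Unique-++⁻ (outVars c) u
  same-out-position {c ∷ Q} u (here refl) (here refl) p q | u₁ , _ , _ =
    cong (c ,_) (same-position (outs c) u₁ p q)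
  same-out-position {c ∷ Q} {b = b} {i} {j} u (here refl) (there b∈) p q | _ , _ , d =
    ⊥-elim (d (lookup-⊆ (outs c) i p , ∈-concatMap-intro b∈ (lookup-⊆ (outs b) j q)))
  same-out-position {c ∷ Q} {a} {i = i} {j} u (there a∈) (here refl) p q | _ , _ , d =
    ⊥-elim (d (lookup-⊆ (outs c) j q , ∈-concatMap-intro a∈ (lookup-⊆ (outs a) i p)))
  same-out-position {c ∷ Q} u (there a∈) (there b∈) p q | _ , u₂ , _ =
    same-out-position u₂ a∈ b∈ p q

  inVars-⊆ : ∀ {Q a} → a ∈ₗ Q → inVars a ⊆ varsᵠ Q
  inVars-⊆ a∈ p = ∈-concatMap-intro a∈ (∈-++⁺ˡ p)

  outVars-⊆ : ∀ {Q a} → a ∈ₗ Q → outVars a ⊆ outVarsᵠ Q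
  outVars-⊆ a∈ p = ∈-concatMap-intro a∈ p

  outVarsᵠ-⊆ : ∀ Q → outVarsᵠ Q ⊆ varsᵠ Q
  outVarsᵠ-⊆ Q p with ∈-concatMap-∃ {f = outVars} {xs = Q} p
  ... | a , a∈ , q = ∈-concatMap-intro a∈ (∈-++⁺ʳ (inVars a) q)

  opaque
    upd : List Var → Subst → Subst → Subst
    upd xs σ δ x with x ∈? xs
    ... | yes _ = σ x
    ... | no  _ = δ x

    upd-∈ : ∀ {xs σ δ x} → x ∈ₗ xs → upd xs σ δ x ≡ σ x
    upd-∈ {xs} {x = x} p with x ∈? xs
    ... | yes _ = refl
    ... | no  n = contradiction p n

    upd-∉ : ∀ {xs σ δ x} → x ∉ₗ xs → upd xs σ δ x ≡ δ x
    upd-∉ {xs} {x = x} p with x ∈? xs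
    ... | yes q = contradiction q p
    ... | no  _ = refl

  IsVar? : ∀ t → Dec (IsVar t)
  IsVar? (var x)   = yes (x , refl)
  IsVar? (app f _) = no λ ()

  IsVar-[]⁻ : ∀ t {σ} → IsVar (t [ σ ]ᵗ) → IsVar t
  IsVar-[]⁻ (var x) _ = x , refl

  opaque
    -- Linearity gives different positions disjoint variables, so substitutions chosen position by
    -- position can be glued.
    gather : ∀ {n} (ts : Vec Term n) → Unique (varsᵛ ts) → (σs : Fin n → Subst) →
             ∃[ σ ] (∀ i → lookup ts i [ σ ]ᵗ ≡ lookup ts i [ σs i ]ᵗ)
    gather []       _ _  = var , λ ()
    gather (t ∷ ts) u σs with Unique-++⁻ (vars t) u
    ... | _ , u₂ , d with gather ts u₂ (σs ∘ suc)
    ... | σ , eq = upd (vars t) (σs zero) σ , λ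
      { zero    → []-congᵗ t upd-∈
      ; (suc i) → trans ([]-congᵗ (lookup ts i) (λ p → upd-∉ (λ q → d (q , lookup-⊆ ts i p)))) (eq i) }

  varsᵛ-map-var : ∀ {n} (xs : Vec Var n) → varsᵛ (Vec.map var xs) ≡ toList xs
  varsᵛ-map-var []       = refl
  varsᵛ-map-var (x ∷ xs) = cong (x ∷_) (varsᵛ-map-var xs)

  lookup-map-var : ∀ {n} (xs : Vec Var n) i → lookup (Vec.map var xs) i ≡ var (lookup xs i)
  lookup-map-var (x ∷ xs) zero    = refl
  lookup-map-var (x ∷ xs) (suc i) = lookup-map-var xs i

  lookup-ext : ∀ {A : Set} {n} {xs ys : Vec A n} → (∀ i → lookup xs i ≡ lookup ys i) → xs ≡ ys
  lookup-ext {xs = []}     {[]}     _ = refl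
  lookup-ext {xs = x ∷ xs} {y ∷ ys} h = cong₂ _∷_ (h zero) (lookup-ext (h ∘ suc))

  lookup-ext-[] : ∀ {n} {ts us : Vec Term n} {σ} → (∀ i → lookup ts i [ σ ]ᵗ ≡ lookup us i) → ts [ σ ]ᵛ ≡ us
  lookup-ext-[] {ts = ts} {σ = σ} h = lookup-ext λ i → trans (lookup-[] ts σ i) (h i)

  -- For a flat `t` equality of root symbols is all that matching requires, because its arguments
  -- are distinct variables. A variable `t` imposes no condition.
  HasShape : Term → Term → Set
  HasShape t r = ∀ {f ts} → t ≡ app f ts → ∃[ rs ] r ≡ app f rs

  match-flat : ∀ {t r} → Flat t → HasShape t r → ∃[ σ ] t [ σ ]ᵗ ≡ r
  match-flat {r = r} (flat-var x) _ = (λ _ → r) , refl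
  match-flat (flat-app f xs u) shape with shape refl
  ... | rs , refl with gather (Vec.map var xs) (subst Unique (sym (varsᵛ-map-var xs)) u) (λ i _ → lookup rs i)
  ... | σ , eq = σ , cong (app f) (lookup-ext-[] λ i →
        trans (eq i) (cong (_[ (λ _ → lookup rs i) ]ᵗ) (lookup-map-var xs i)))

  opaque
    match-linear : ∀ {n} (ts rs : Vec Term n) → Unique (varsᵛ ts) → (∀ i → Flat (lookup ts i)) →
                   (∀ i → HasShape (lookup ts i) (lookup rs i)) → ∃[ σ ] ts [ σ ]ᵛ ≡ rs
    match-linear ts rs u flat shape =
      let σs       = λ i → match-flat (flat i) (shape i)
          (σ , eq) = gather ts u (proj₁ ∘ σs)
      in σ , lookup-ext-[] λ i → trans (eq i) (proj₂ (σs i))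

-- Unification that leaves the selected inputs alone.

module Resolution (em : ExcludedMiddle 0ℓ) (S : Signature) where
  open Syntax S
  open Substitutions S

  -- An mgu of a selected atom p(s , t) and a clause head p(v , u) that does not
  -- instantiate s.
  record ConsumingMGU {p} (s : Vec Term (inArity p)) (t : Vec Term (outArity p))
                          (v : Vec Term (inArity p)) (u : Vec Term (outArity p))
                          (η : Subst) : Set where
    field
      unifies   : Unifier (atom p s t) (atom p v u) η
      universal : ∀ δ → Unifier (atom p s t) (atom p v u) δ → ∀ x → δ x ≡ η x [ δ ]ᵗ
      fixes     : ∀ {x} → x ∉ₗ varsᵛ t → x ∉ₗ varsᵃ (atom p v u) → η x ≡ var x
      head-in   : ∀ {x} → x ∈ₗ varsᵛ v → vars (η x) ⊆ varsᵛ s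
      link      : ∀ {x} → x ∉ₗ varsᵛ v → x ∉ₗ varsᵛ t →
                  η x ≡ var x ⊎
                  ∃[ j ] (lookup u j ≡ var x × η x ≡ lookup t j × ¬ IsVar (lookup t j))
      scope-out : ∀ {x} → x ∈ₗ varsᵛ t → vars (η x) ⊆ varsᵃ (atom p s t) ++ varsᵃ (atom p v u)

    scope : ∀ x → vars (η x) ⊆ x ∷ varsᵃ (atom p s t) ++ varsᵃ (atom p v u)
    scope x q with x ∈? varsᵛ t
    ... | yes x∈t = there (scope-out x∈t q)
    ... | no  x∉t with x ∈? varsᵛ v
    ... | yes x∈v = there (∈-++⁺ˡ (∈-++⁺ˡ (head-in x∈v q)))
    ... | no  x∉v with link x∉v x∉t
    ... | inj₁ eq = here (case vars-≡ (η x) eq q of λ { (here e) → e })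
    ... | inj₂ (j , _ , eq , _) =
      there (∈-++⁺ˡ (∈-++⁺ʳ (varsᵛ s) (lookup-⊆ t j (vars-≡ (η x) eq q))))

  app-functor : ∀ {f g ts us} → app f ts ≡ app g us → f ≡ g
  app-functor refl = refl

  same-shape : ∀ r {t δ} → ¬ IsVar r → t [ δ ]ᵗ ≡ r [ δ ]ᵗ → HasShape t r
  same-shape (var x)    n _    _    = contradiction (x , refl) n
  same-shape (app g rs) _ e    refl = case app-functor e of λ { refl → rs , refl }

  module _ {p} {s v : Vec Term (inArity p)} {t u : Vec Term (outArity p)}
    (apart      : Disjoint (varsᵃ (atom p v u)) (varsᵃ (atom p s t)))
    (out-linear : Unique (varsᵛ t))
    (in-out     : Disjoint (varsᵛ s) (varsᵛ t))
    (in-linear  : Unique (varsᵛ v))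
    (in-match   : ∀ i → IsVar (lookup v i) ⊎ (Flat (lookup v i) × ¬ IsVar (lookup s i)))
    (out-flat   : ∀ j → Flat (lookup t j))
    (out-in     : ∀ {j x} → ¬ IsVar (lookup t j) → lookup u j ≡ var x → x ∈ₗ varsᵛ v →
                  ∃[ i ] (lookup v i ≡ var x × ¬ IsVar (lookup s i)))
    where

    private
      -- The mgu is built from two matchings, so no occurs check arises: head inputs `v` against
      -- `s`, then `t` against the instantiated head outputs. The given unifier `δ` serves only to
      -- compare root symbols.
      module Construction {δ} (unif : Unifier (atom p s t) (atom p v u) δ) where

        pointwise-in : ∀ {δ} → Unifier (atom p s t) (atom p v u) δ →
                       ∀ i → lookup v i [ δ ]ᵗ ≡ lookup s i [ δ ]ᵗ
        pointwise-in {δ} e i =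
          trans (sym (lookup-[] v δ i))
                (trans (cong (λ ts → lookup ts i) (sym (proj₁ (atom-injective e)))) (lookup-[] s δ i))

        pointwise-out : ∀ {δ} → Unifier (atom p s t) (atom p v u) δ →
                        ∀ j → lookup t j [ δ ]ᵗ ≡ lookup u j [ δ ]ᵗ
        pointwise-out {δ} e j =
          trans (sym (lookup-[] t δ j))
                (trans (cong (λ ts → lookup ts j) (proj₂ (atom-injective e))) (lookup-[] u δ j))

        out-var : ∀ {δ j x} → Unifier (atom p s t) (atom p v u) δ →
                  lookup u j ≡ var x → δ x ≡ lookup t j [ δ ]ᵗ
        out-var {δ} {j} e eq = trans (sym (cong (_[ δ ]ᵗ) eq)) (sym (pointwise-out e j))

        v-flat : ∀ i → Flat (lookup v i)
        v-flat i with in-match i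
        ... | inj₁ (x , eq)  = subst Flat (sym eq) (flat-var x)
        ... | inj₂ (fl , _) = fl

        v-shape : ∀ i → HasShape (lookup v i) (lookup s i)
        v-shape i with in-match i
        ... | inj₁ (_ , eq) = λ eq′ → case trans (sym eq) eq′ of λ ()
        ... | inj₂ (_ , n)  = same-shape (lookup s i) n (pointwise-in unif i)

        σ : Subst
        σ = proj₁ (match-linear v s in-linear v-flat v-shape)

        vσ≡s : v [ σ ]ᵛ ≡ s
        vσ≡s = proj₂ (match-linear v s in-linear v-flat v-shape)

        Linked : Var → Set
        Linked x = ∃[ j ] (lookup u j ≡ var x × ¬ IsVar (lookup t j))

        -- A head output variable facing a non-variable output term must be bound before `t` can be
        -- matched against `u`. If it faces several such terms, any one will do: unifiability gives
        -- the others the same root symbol, so they match it.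
        linked : Subst
        linked x with em {P = Linked x}
        ... | yes (j , _) = lookup t j
        ... | no  _       = var x

        linked-cases : ∀ x → (¬ Linked x × linked x ≡ var x) ⊎
                       ∃[ j ] (lookup u j ≡ var x × linked x ≡ lookup t j × ¬ IsVar (lookup t j))
        linked-cases x with em {P = Linked x}
        ... | yes (j , eq , n) = inj₂ (j , eq , refl , n)
        ... | no  n            = inj₁ (n , refl)

        ηᶜ : Subst
        ηᶜ = upd (varsᵛ v) σ linked

        t-shape : ∀ j → HasShape (lookup t j) (lookup (u [ ηᶜ ]ᵛ) j)
        t-shape j {f} eq = subst (λ r → ∃[ rs ] r ≡ app f rs) (sym (lookup-[] u ηᶜ j)) shape
          where
          nonvar : ¬ IsVar (lookup t j)
          nonvar (x , e) = case trans (sym e) eq of λ ()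
          shape : ∃[ rs ] lookup u j [ ηᶜ ]ᵗ ≡ app f rs
          shape with lookup u j in uj
          ... | app g us with same-shape (app g us) {δ = δ} (λ ())
                                (trans (pointwise-out unif j) (cong (_[ δ ]ᵗ) uj)) eq
          ... | _ , refl = _ , refl
          shape | var x with x ∈? varsᵛ v
          -- Here `σ` has already fixed the value of `x`. By `out-in` that value is a non-variable
          -- input term, and unifiability gives it the root symbol of the output term.
          ... | yes x∈v =
            let (i , vi , n) = out-in nonvar uj x∈v
                σx≡si = trans (cong (_[ σ ]ᵗ) (sym vi))
                          (trans (sym (lookup-[] v σ i)) (cong (λ ts → lookup ts i) vσ≡s))
                (rs , e) = same-shape (lookup s i) n
                  (trans (sym (out-var unif uj))
                    (trans (sym (cong (_[ δ ]ᵗ) vi)) (pointwise-in unif i))) eq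
            in rs , trans (upd-∈ x∈v) (trans σx≡si e)
          ... | no  x∉v with linked-cases x
          ... | inj₁ (n , _) = contradiction (j , uj , nonvar) n
          ... | inj₂ (k , uk , e , n) =
            let (rs , e′) = same-shape (lookup t k) n (trans (sym (out-var unif uj)) (out-var unif uk)) eq
            in rs , trans (upd-∉ x∉v) (trans e e′)

        μ : Subst
        μ = proj₁ (match-linear t (u [ ηᶜ ]ᵛ) out-linear out-flat t-shape)

        tμ≡uηᶜ : t [ μ ]ᵛ ≡ u [ ηᶜ ]ᵛ
        tμ≡uηᶜ = proj₂ (match-linear t (u [ ηᶜ ]ᵛ) out-linear out-flat t-shape)

        η : Subst
        η = upd (varsᵛ t) μ ηᶜ

        v∉t : ∀ {x} → x ∈ₗ varsᵛ v → x ∉ₗ varsᵛ t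
        v∉t q r = apart (∈-++⁺ˡ q , ∈-++⁺ʳ (varsᵛ s) r)

        u∉t : ∀ {x} → x ∈ₗ varsᵛ u → x ∉ₗ varsᵛ t
        u∉t q r = apart (∈-++⁺ʳ (varsᵛ v) q , ∈-++⁺ʳ (varsᵛ s) r)

        η-fixes : ∀ {x} → x ∉ₗ varsᵛ t → x ∉ₗ varsᵃ (atom p v u) → η x ≡ var x
        η-fixes {x} x∉t x∉h =
          trans (upd-∉ x∉t) (trans (upd-∉ (x∉h ∘ ∈-++⁺ˡ)) linked≡var)
          where
          linked≡var : linked x ≡ var x
          linked≡var with linked-cases x
          ... | inj₁ (_ , e) = e
          ... | inj₂ (j , e , _) = contradiction (∈-++⁺ʳ (varsᵛ v) (lookup-varᵛ u j e)) x∉h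

        vη≡s : v [ η ]ᵛ ≡ s
        vη≡s = trans ([]-congᵛ v (λ q → trans (upd-∉ (v∉t q)) (upd-∈ q))) vσ≡s

        sη≡s : s [ η ]ᵛ ≡ s
        sη≡s = trans ([]-congᵛ s (λ q → η-fixes (λ r → in-out (q , r)) (λ r → apart (r , ∈-++⁺ˡ q))))
                     ([]-idᵛ s)

        tη≡uη : t [ η ]ᵛ ≡ u [ η ]ᵛ
        tη≡uη = trans ([]-congᵛ t upd-∈) (trans tμ≡uηᶜ ([]-congᵛ u (λ q → sym (upd-∉ (u∉t q)))))

        -- Equal instances of a vector agree on its variables. A unifier sends `v` and its instance
        -- under `σ` to the same vector, because that instance is `s`.
        ηᶜ-universal : ∀ δ → Unifier (atom p s t) (atom p v u) δ → ∀ x → δ x ≡ ηᶜ x [ δ ]ᵗ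
        ηᶜ-universal δ e x with x ∈? varsᵛ v
        ... | yes x∈v = trans
          ([]-injᵛ v (trans (sym (proj₁ (atom-injective e)))
            (trans (cong (_[ δ ]ᵛ) (sym vσ≡s)) (⨟-termᵛ v))) x∈v)
          (sym (cong (_[ δ ]ᵗ) (upd-∈ x∈v)))
        ... | no  x∉v with linked-cases x
        ... | inj₁ (_ , eq)           = sym (cong (_[ δ ]ᵗ) (trans (upd-∉ x∉v) eq))
        ... | inj₂ (j , uj , eq , _) = trans (out-var e uj) (sym (cong (_[ δ ]ᵗ) (trans (upd-∉ x∉v) eq)))

        η-universal : ∀ δ → Unifier (atom p s t) (atom p v u) δ → ∀ x → δ x ≡ η x [ δ ]ᵗ
        η-universal δ e x with x ∈? varsᵛ t
        ... | no  x∉t = trans (ηᶜ-universal δ e x) (sym (cong (_[ δ ]ᵗ) (upd-∉ x∉t)))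
        ... | yes x∈t = trans
          ([]-injᵛ t
            (trans (proj₂ (atom-injective e))
            (trans ([]-congᵛ u (λ _ → ηᶜ-universal δ e _))
            (trans (sym (⨟-termᵛ u))
            (trans (cong (_[ δ ]ᵛ) (sym tμ≡uηᶜ)) (⨟-termᵛ t))))) x∈t)
          (sym (cong (_[ δ ]ᵗ) (upd-∈ x∈t)))

        σ-scope : ∀ {x} → x ∈ₗ varsᵛ v → vars (σ x) ⊆ varsᵛ s
        σ-scope x∈v q = subst (λ ts → _ ∈ₗ varsᵛ ts) vσ≡s (∈-[]ˡ⁺ σ (vars-[]ᵛ v σ) x∈v q)

        η-scope-out : ∀ {x} → x ∈ₗ varsᵛ t → vars (η x) ⊆ varsᵃ (atom p s t) ++ varsᵃ (atom p v u)
        η-scope-out {x} x∈t {y} q with ∈-[]ˡ⁻ ηᶜ (vars-[]ᵛ u ηᶜ)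
          (subst (λ ts → y ∈ₗ varsᵛ ts) tμ≡uηᶜ
            (∈-[]ˡ⁺ μ (vars-[]ᵛ t μ) x∈t (vars-≡ (η x) (upd-∈ x∈t) q)))
        ... | z , z∈u , r with z ∈? varsᵛ v
        ... | yes z∈v = ∈-++⁺ˡ (∈-++⁺ˡ (σ-scope z∈v (vars-≡ (ηᶜ z) (upd-∈ z∈v) r)))
        ... | no  z∉v with linked-cases z
        ... | inj₂ (j , _ , eq , _) =
          ∈-++⁺ˡ (∈-++⁺ʳ (varsᵛ s) (lookup-⊆ t j (vars-≡ (ηᶜ z) (trans (upd-∉ z∉v) eq) r)))
        ... | inj₁ (_ , eq) with vars-≡ (ηᶜ z) (trans (upd-∉ z∉v) eq) r
        ... | here refl = ∈-++⁺ʳ (varsᵃ (atom p s t)) (∈-++⁺ʳ (varsᵛ v) z∈u)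

        η-link : ∀ {x} → x ∉ₗ varsᵛ v → x ∉ₗ varsᵛ t → η x ≡ var x ⊎
                 ∃[ j ] (lookup u j ≡ var x × η x ≡ lookup t j × ¬ IsVar (lookup t j))
        η-link {x} x∉v x∉t with linked-cases x
        ... | inj₁ (_ , e) = inj₁ (trans (upd-∉ x∉t) (trans (upd-∉ x∉v) e))
        ... | inj₂ (j , uj , e , n) = inj₂ (j , uj , trans (upd-∉ x∉t) (trans (upd-∉ x∉v) e) , n)

    opaque
      consuming-mgu : ∀ {δ} → Unifier (atom p s t) (atom p v u) δ → ∃[ η ] ConsumingMGU s t v u η
      consuming-mgu unif = η , record
        { unifies   = cong₂ (atom p) (trans sη≡s (sym vη≡s)) tη≡uη
        ; universal = η-universal
        ; fixes     = η-fixes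
        ; head-in   = λ q r → σ-scope q (vars-≡ (η _) (trans (upd-∉ (v∉t q)) (upd-∈ q)) r)
        ; link      = η-link
        ; scope-out = η-scope-out
        }
        where open Construction unif

-- Nicely moded, well typed and robustly typed queries.

module RobustTyping (em : ExcludedMiddle 0ℓ) (S : Signature) (τ : Syntax.Typing S) where
  open Syntax S
  open Typing τ
  open Typed S τ
  open Substitutions S
  open Resolution em S

  VarOn : List Var → Subst → Set
  VarOn xs ρ = ∀ {x} → x ∈ₗ xs → IsVar (ρ x)

  VarOn-nonempty : ∀ {xs ρ} → VarOn xs ρ → ∀ {x} → x ∈ₗ xs → ∃[ y ] y ∈ₗ vars (ρ x)
  VarOn-nonempty {ρ = ρ} h {x} p with ρ x | h p
  ... | _ | y , refl = y , here refl

  Unique-[]ˡ⁻ : ∀ {xs ys} ρ → VarOn xs ρ → ys ≡ xs [ ρ ]ˡ → Unique ys → Unique xs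
  Unique-[]ˡ⁻ ρ h refl = Unique-concatMap⁻ (VarOn-nonempty {ρ = ρ} h)

  Disjoint-[]ˡ⁻ : ∀ {xs ys xs′ ys′} ρ → VarOn ys ρ → xs′ ≡ xs [ ρ ]ˡ → ys′ ≡ ys [ ρ ]ˡ →
                  Disjoint xs′ ys′ → Disjoint xs ys
  Disjoint-[]ˡ⁻ ρ h e e′ d (p , q) with VarOn-nonempty {ρ = ρ} h q
  ... | _ , r = d (∈-[]ˡ⁺ ρ e p r , ∈-[]ˡ⁺ ρ e′ q r)

  flat-args : ∀ {f ts} → Flat (app f ts) → Unique (varsᵛ ts) × (∀ i → IsVar (lookup ts i))
  flat-args (flat-app f xs u) =
    subst Unique (sym (varsᵛ-map-var xs)) u , λ i → lookup xs i , lookup-map-var xs i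

  all-vars : ∀ {n} (ts : Vec Term n) → (∀ i → IsVar (lookup ts i)) → ∃[ xs ] ts ≡ Vec.map var xs
  all-vars []       _ = [] , refl
  all-vars (t ∷ ts) h =
    let (x , e) = h zero ; (xs , e′) = all-vars ts (h ∘ suc) in x ∷ xs , cong₂ _∷_ e e′

  args-flat : ∀ {f ts} → Unique (varsᵛ ts) → (∀ i → IsVar (lookup ts i)) → Flat (app f ts)
  args-flat {f} {ts} u h with all-vars ts h
  ... | xs , refl = flat-app f xs (subst Unique (varsᵛ-map-var xs) u)

  Flat-[]⁻ : ∀ t {ρ} → VarOn (vars t) ρ → Flat (t [ ρ ]ᵗ) → Flat t
  Flat-[]⁻ (var x)        _ _  = flat-var x
  Flat-[]⁻ (app f ts) {ρ} h fl with flat-args fl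
  ... | u , vs = args-flat (Unique-[]ˡ⁻ ρ h (vars-[]ᵛ ts ρ) u)
    λ i → IsVar-[]⁻ (lookup ts i) (subst IsVar (lookup-[] ts ρ i) (vs i))

  -- Below its root a flat term has only variables, so nothing can be instantiated there. A variable
  -- at the root could still become a compound flat term, hence the restriction on `t`.
  Flat-[]-VarOn : ∀ t {ρ} → ¬ IsVar t → Flat (t [ ρ ]ᵗ) → VarOn (vars t) ρ
  Flat-[]-VarOn (var x)        n _  = contradiction (x , refl) n
  Flat-[]-VarOn (app f ts) {ρ} n fl p with ∈-lookup ts p
  ... | i , q with lookup ts i | lookup-[] ts ρ i | proj₂ (flat-args fl) i
  Flat-[]-VarOn (app f ts) n fl p | i , here refl | var y | e | v = subst IsVar e v
  ... | app _ _ | e | (_ , e′) = case trans (sym e) e′ of λ ()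

  inVarsᵠ : Query → List Var
  inVarsᵠ = concatMap inVars

  varsᵠ-cases : ∀ Q {x} → x ∈ₗ varsᵠ Q → x ∈ₗ inVarsᵠ Q ⊎ x ∈ₗ outVarsᵠ Q
  varsᵠ-cases Q p with ∈-concatMap-∃ {f = varsᵃ} {xs = Q} p
  ... | a , a∈ , q with ∈-++⁻ (inVars a) q
  ... | inj₁ r = inj₁ (∈-concatMap-intro a∈ r)
  ... | inj₂ r = inj₂ (∈-concatMap-intro a∈ r)

  inVarsᵠ-⊆ : ∀ Q → inVarsᵠ Q ⊆ varsᵠ Q
  inVarsᵠ-⊆ Q p with ∈-concatMap-∃ {f = inVars} {xs = Q} p
  ... | a , a∈ , q = inVars-⊆ {Q = Q} a∈ q

  inVars-[]ᵠ : ∀ Q σ → inVarsᵠ (Q [ σ ]ᵠ) ≡ inVarsᵠ Q [ σ ]ˡ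
  inVars-[]ᵠ []      σ = refl
  inVars-[]ᵠ (a ∷ Q) σ =
    trans (cong₂ _++_ (vars-[]ᵛ (ins a) σ) (inVars-[]ᵠ Q σ))
          (sym (concatMap-++ (vars ∘ σ) (inVars a) (inVarsᵠ Q)))

  -- Structural form of the input condition of `NicelyModed`, suited to induction on the query.
  Moded : Query → Set
  Moded []      = ⊤
  Moded (a ∷ Q) = Disjoint (inVars a) (outVarsᵠ (a ∷ Q)) × Moded Q

  Moded⁺ : ∀ Q → (∀ Q₁ a Q₂ → Q ≡ Q₁ ++ a ∷ Q₂ → Disjoint (inVars a) (outVarsᵠ (a ∷ Q₂))) → Moded Q
  Moded⁺ []      h = tt
  Moded⁺ (a ∷ Q) h = h [] a Q refl , Moded⁺ Q (λ Q₁ b Q₂ e → h (a ∷ Q₁) b Q₂ (cong (a ∷_) e))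

  Moded⁻ : ∀ Q₁ {a Q₂} → Moded (Q₁ ++ a ∷ Q₂) → Disjoint (inVars a) (outVarsᵠ (a ∷ Q₂))
  Moded⁻ []       (d , _) = d
  Moded⁻ (_ ∷ Q₁) (_ , m) = Moded⁻ Q₁ m

  Moded-++⁺ : ∀ Q₁ {Q₂} → Moded Q₁ → Moded Q₂ → Disjoint (inVarsᵠ Q₁) (outVarsᵠ Q₂) → Moded (Q₁ ++ Q₂)
  Moded-++⁺ []            _        m₂ _ = m₂
  Moded-++⁺ (a ∷ Q₁) {Q₂} (d , m₁) m₂ e =
    head-disjoint , Moded-++⁺ Q₁ m₁ m₂ λ (p , q) → e (∈-++⁺ʳ (inVars a) p , q)
    where
    head-disjoint : Disjoint (inVars a) (outVars a ++ outVarsᵠ (Q₁ ++ Q₂))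
    head-disjoint (p , q) with ∈-++⁻ (outVars a) q
    ... | inj₁ r = d (p , ∈-++⁺ˡ r)
    ... | inj₂ r with ∈-++⁻ (outVarsᵠ Q₁) (subst (_ ∈ₗ_) (concatMap-++ outVars Q₁ Q₂) r)
    ... | inj₁ r′ = d (p , ∈-++⁺ʳ (outVars a) r′)
    ... | inj₂ r′ = e (∈-++⁺ˡ p , r′)

  Moded-++⁻ : ∀ Q₁ {Q₂} → Moded (Q₁ ++ Q₂) → Moded Q₁ × Moded Q₂ × Disjoint (inVarsᵠ Q₁) (outVarsᵠ Q₂)
  Moded-++⁻ []            m       = tt , m , λ ()
  Moded-++⁻ (a ∷ Q₁) {Q₂} (d , m) with Moded-++⁻ Q₁ m
  ... | m₁ , m₂ , e = (d ∘ extend , m₁) , m₂ , both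
    where
    split = concatMap-++ outVars Q₁ Q₂
    extend : ∀ {x} → x ∈ₗ inVars a × x ∈ₗ outVarsᵠ (a ∷ Q₁) → x ∈ₗ inVars a × x ∈ₗ outVarsᵠ (a ∷ Q₁ ++ Q₂)
    extend (p , q) with ∈-++⁻ (outVars a) q
    ... | inj₁ r = p , ∈-++⁺ˡ r
    ... | inj₂ r = p , ∈-++⁺ʳ (outVars a) (subst (_ ∈ₗ_) (sym split) (∈-++⁺ˡ r))
    both : Disjoint (inVars a ++ inVarsᵠ Q₁) (outVarsᵠ Q₂)
    both (p , q) with ∈-++⁻ (inVars a) p
    ... | inj₁ r = d (r , ∈-++⁺ʳ (outVars a) (subst (_ ∈ₗ_) (sym split) (∈-++⁺ʳ (outVarsᵠ Q₁) q)))
    ... | inj₂ r = e (r , q)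

  Moded-[]⁺ : ∀ Q {σ} → Moded Q →
              (∀ {z x} → z ∈ₗ inVarsᵠ Q → x ∈ₗ outVarsᵠ Q → z ≢ x → Disjoint (vars (σ z)) (vars (σ x))) →
              Moded (Q [ σ ]ᵠ)
  Moded-[]⁺ []          _       _   = tt
  Moded-[]⁺ (a ∷ Q) {σ} (d , m) sep =
    head-disjoint , Moded-[]⁺ Q m λ p q → sep (∈-++⁺ʳ (inVars a) p) (∈-++⁺ʳ (outVars a) q)
    where
    head-disjoint : Disjoint (inVars (a [ σ ]ᵃ)) (outVarsᵠ ((a ∷ Q) [ σ ]ᵠ))
    head-disjoint (p , q) with ∈-[]ˡ⁻ σ (vars-[]ᵛ (ins a) σ) p | ∈-[]ˡ⁻ σ (outVars-[]ᵠ (a ∷ Q) σ) q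
    ... | z , z∈ , p′ | x , x∈ , q′ with z ≟ x
    ... | yes refl = d (z∈ , x∈)
    ... | no  z≢x  = sep (∈-++⁺ˡ z∈) x∈ z≢x (p′ , q′)

  Moded-[]⁻ : ∀ Q {ρ} → VarOn (outVarsᵠ Q) ρ → Moded (Q [ ρ ]ᵠ) → Moded Q
  Moded-[]⁻ []          _ _       = tt
  Moded-[]⁻ (a ∷ Q) {ρ} h (d , m) =
    Disjoint-[]ˡ⁻ ρ h (vars-[]ᵛ (ins a) ρ) (outVars-[]ᵠ (a ∷ Q) ρ) d ,
    Moded-[]⁻ Q (h ∘ ∈-++⁺ʳ (outVars a)) m

  -- Well-typedness of one instance of a query, in structural form: past an incorrectly typed output
  -- nothing is required.
  Chain : Query → Set
  Chain []      = ⊤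
  Chain (a ∷ Q) = InTyped a × (OutTyped a → Chain Q)

  Chain⁺ : ∀ Q {σ} → (∀ Q₁ a Q₂ → Q ≡ Q₁ ++ a ∷ Q₂ → All OutTyped (Q₁ [ σ ]ᵠ) → InTyped (a [ σ ]ᵃ)) →
           Chain (Q [ σ ]ᵠ)
  Chain⁺ []      h = tt
  Chain⁺ (a ∷ Q) h = h [] a Q refl [] , λ o →
    Chain⁺ Q (λ Q₁ b Q₂ e os → h (a ∷ Q₁) b Q₂ (cong (a ∷_) e) (o ∷ os))

  Chain⁻ : ∀ Q₁ {a Q₂} → Chain (Q₁ ++ a ∷ Q₂) → All OutTyped Q₁ → InTyped a
  Chain⁻ []       (i , _) _        = i
  Chain⁻ (_ ∷ Q₁) (_ , c) (o ∷ os) = Chain⁻ Q₁ (c o) os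

  Chain-++ˡ : ∀ Q₁ {Q₂} → Chain (Q₁ ++ Q₂) → Chain Q₁
  Chain-++ˡ []       _       = tt
  Chain-++ˡ (_ ∷ Q₁) (i , c) = i , Chain-++ˡ Q₁ ∘ c

  Chain-++ʳ : ∀ Q₁ {Q₂} → Chain (Q₁ ++ Q₂) → All OutTyped Q₁ → Chain Q₂
  Chain-++ʳ []       c       []       = c
  Chain-++ʳ (_ ∷ Q₁) (_ , c) (o ∷ os) = Chain-++ʳ Q₁ (c o) os

  Chain-++⁺ : ∀ Q₁ {Q₂} → Chain Q₁ → (All OutTyped Q₁ → Chain Q₂) → Chain (Q₁ ++ Q₂)
  Chain-++⁺ []       _       k = k []
  Chain-++⁺ (_ ∷ Q₁) (i , c) k = i , λ o → Chain-++⁺ Q₁ (c o) (k ∘ (o ∷_))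

  record ClauseChain (h : Atom) (B : Query) : Set where
    constructor _,_
    field
      body-chain : Chain B
      head-typed : All OutTyped B → OutTyped h

  -- Atoms to the right rely on `a` only through its outputs, and these are correct once the outputs
  -- of `B` are.
  Chain-resolve : ∀ Q₁ {a Q₂ B} → Chain (Q₁ ++ a ∷ Q₂) → (InTyped a → ClauseChain a B) → Chain (Q₁ ++ B ++ Q₂)
  Chain-resolve []       {B = B} (i , c) k = let (b , o) = k i in Chain-++⁺ B b (c ∘ o)
  Chain-resolve (_ ∷ Q₁)         (i , c) k = i , λ o → Chain-resolve Q₁ (c o) k

  []-++ : ∀ Q₁ Q₂ σ → (Q₁ ++ Q₂) [ σ ]ᵠ ≡ Q₁ [ σ ]ᵠ ++ Q₂ [ σ ]ᵠ
  []-++ Q₁ Q₂ σ = map-++ (_[ σ ]ᵃ) Q₁ Q₂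

  OutTyped-lookup : ∀ a {σ} → (∀ i → lookup (outs a) i [ σ ]ᵗ ∈ ⟦ outType (pred a) i ⟧) → OutTyped (a [ σ ]ᵃ)
  OutTyped-lookup a {σ} h i = subst (_∈ ⟦ outType (pred a) i ⟧) (sym (lookup-[] (outs a) σ i)) (h i)

  OutTyped-cong : ∀ a {σ δ} → AgreeOn (outVars a) σ δ → OutTyped (a [ σ ]ᵃ) → OutTyped (a [ δ ]ᵃ)
  OutTyped-cong a h o i =
    subst (λ ts → lookup ts i ∈ ⟦ outType (pred a) i ⟧) ([]-congᵛ (outs a) h) (o i)

  module RobustQueries (P : Program) where

    -- Robust typing without its semantic half, well-typedness. Resolution preserves it by itself,
    -- and simulation asks no more of a copy.
    record Nice (Q : Query) : Set where
      field
        linear : Unique (outVarsᵠ Q)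
        moded  : Moded Q
        robust : All (RobustOuts P) Q

    record RT (Q : Query) : Set where
      field
        nice  : Nice Q
        chain : ∀ σ → Chain (Q [ σ ]ᵠ)
      open Nice nice public

    RT⁺ : ∀ {Q} → RobustlyTyped P Q → RT Q
    RT⁺ {Q} ((u , m) , w , r) = record
      { nice  = record { linear = u ; moded = Moded⁺ Q m ; robust = r }
      ; chain = λ σ → Chain⁺ Q (λ Q₁ a Q₂ e → w Q₁ a Q₂ e σ) }

    RT⁻ : ∀ {Q} → RT Q → RobustlyTyped P Q
    RT⁻ {Q} rt = (linear , λ { Q₁ a Q₂ refl → Moded⁻ Q₁ moded }) ,
      (λ { Q₁ a Q₂ refl σ → Chain⁻ (Q₁ [ σ ]ᵠ) (subst Chain ([]-++ Q₁ (a ∷ Q₂) σ) (chain σ)) }) , robust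
      where open RT rt

    Nice-++⁻ : ∀ Q₁ {Q₂} → Nice (Q₁ ++ Q₂) → Nice Q₁ × Nice Q₂
    Nice-++⁻ Q₁ {Q₂} n with Unique-++⁻ (outVarsᵠ Q₁) (subst Unique (concatMap-++ outVars Q₁ Q₂) (Nice.linear n))
                          | Moded-++⁻ Q₁ (Nice.moded n)
    ... | u₁ , u₂ , _ | m₁ , m₂ , _ =
      record { linear = u₁ ; moded = m₁ ; robust = All.++⁻ˡ Q₁ (Nice.robust n) } ,
      record { linear = u₂ ; moded = m₂ ; robust = All.++⁻ʳ Q₁ (Nice.robust n) }

    RT-++ˡ : ∀ Q₁ {Q₂} → RT (Q₁ ++ Q₂) → RT Q₁
    RT-++ˡ Q₁ {Q₂} rt = record
      { nice  = proj₁ (Nice-++⁻ Q₁ nice)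
      ; chain = λ σ → Chain-++ˡ (Q₁ [ σ ]ᵠ) (subst Chain ([]-++ Q₁ Q₂ σ) (chain σ)) }
      where open RT rt

    RobustOuts-flat : ∀ a → RobustOuts P a → ∀ i → Flat (lookup (outs a) i)
    RobustOuts-flat a (free , bound) i with em {P = BoundOut P (pred a) i}
    ... | yes b = proj₁ (bound i b)
    ... | no  f with free i f
    ... | x , e = subst Flat (sym e) (flat-var x)

    RobustOuts-[]⁻ : ∀ a {ρ} → VarOn (outVars a) ρ → RobustOuts P (a [ ρ ]ᵃ) → RobustOuts P a
    RobustOuts-[]⁻ a {ρ} h (free , bound) =
      (λ i f → IsVar-[]⁻ (lookup (outs a) i) (subst IsVar (lookup-[] (outs a) ρ i) (free i f))) ,
      (λ i b → let (fl , σ , tc) = bound i b in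
         Flat-[]⁻ (lookup (outs a) i) (h ∘ lookup-⊆ (outs a) i) (subst Flat (lookup-[] (outs a) ρ i) fl) ,
         ρ ⨟ σ , subst (_∈ ⟦ outType (pred a) i ⟧)
                   (trans (cong (_[ σ ]ᵗ) (lookup-[] (outs a) ρ i)) (⨟-termᵗ (lookup (outs a) i))) tc)

    -- A repetition or clash of variables remains visible after any substitution that sends output
    -- variables to variables. This serves both clause variants and queries whose copies are known
    -- to be nice.
    Nice-[]⁻ : ∀ Q {ρ} → VarOn (outVarsᵠ Q) ρ → Nice (Q [ ρ ]ᵠ) → Nice Q
    Nice-[]⁻ Q {ρ} h n = record
      { linear = Unique-[]ˡ⁻ ρ h (outVars-[]ᵠ Q ρ) linear
      ; moded  = Moded-[]⁻ Q h moded
      ; robust = robust⁻ Q h robust }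
      where
      open Nice n
      robust⁻ : ∀ Q → VarOn (outVarsᵠ Q) ρ → All (RobustOuts P) (Q [ ρ ]ᵠ) → All (RobustOuts P) Q
      robust⁻ []      _ []       = []
      robust⁻ (a ∷ Q) h (r ∷ rs) = RobustOuts-[]⁻ a (h ∘ ∈-++⁺ˡ) r ∷ robust⁻ Q (h ∘ ∈-++⁺ʳ (outVars a)) rs

-- Clause variants and their resolvents.

module Steps (em : ExcludedMiddle 0ℓ) (S : Signature) (τ : Syntax.Typing S) (P : Syntax.Program S)
  (robust-program : Typed.RobustlyTypedProgram S τ P)
  (input-linear   : Syntax.InputLinear S P)
  (selectability  : Typed.InputSelectability S τ P)
  where
  open Syntax S
  open Typing τ
  open Typed S τ
  open Substitutions S
  open Resolution em S
  open RobustTyping em S τ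
  open RobustQueries P

  record GoodClause (h : Atom) (B : Query) : Set where
    field
      body-nice     : Nice B
      head-disjoint : Disjoint (inVars h) (outVarsᵠ B)
      head-linear   : Unique (inVars h)
      head-ins      : ∀ i → IsVar (lookup (ins h) i) ⊎ (Flat (lookup (ins h) i) × BoundIn P (pred h) i)
      head-outs     : ∀ {i x} → BoundOut P (pred h) i → lookup (outs h) i ≡ var x →
                      FillsBoundIn P (outType (pred h) i) x h ⊎
                      ∃[ b ] (b ∈ₗ B × FillsBoundOut P (outType (pred h) i) x b)
      typed         : ∀ σ → InTyped (h [ σ ]ᵃ) → ClauseChain (h [ σ ]ᵃ) (B [ σ ]ᵠ)

  opaque
    -- The program speaks about its own clauses only. Since `ρ₁` undoes `ρ₂` on the variables of the
    -- variant, `ρ₂` merely renames there and syntactic properties can be pulled back along it. For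
    -- typing, the instance of the variant by `σ` is an instance of the clause by `ρ₁ ⨟ σ`.
    variant-good : ∀ {c h B} → c ∈ₗ clauses P → Variant c (h ⟵ B) → GoodClause h B
    variant-good {h = h} {B} c∈P ((ρ₁ , e₁) , (ρ₂ , refl)) with All.lookup (proj₂ robust-program) c∈P
    ... | ((linear , moded) , disjoint) , (typed₁ , typed₂) , (free , bound) , robust , fills = record
      { body-nice     = Nice-[]⁻ B (renames ∘ ∈-++⁺ʳ (varsᵃ h) ∘ outVarsᵠ-⊆ B)
                          (record { linear = linear ; moded = Moded⁺ (B [ ρ₂ ]ᵠ) moded ; robust = robust })
      ; head-disjoint = Disjoint-[]ˡ⁻ ρ₂ (renames ∘ ∈-++⁺ʳ (varsᵃ h) ∘ outVarsᵠ-⊆ B)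
                          (vars-[]ᵛ (ins h) ρ₂) (outVars-[]ᵠ B ρ₂) disjoint
      ; head-linear   = Unique-[]ˡ⁻ ρ₂ (renames ∘ ∈-++⁺ˡ ∘ ∈-++⁺ˡ) (vars-[]ᵛ (ins h) ρ₂)
                          (All.lookup (proj₁ input-linear) c∈P)
      ; head-ins      = head-ins
      ; head-outs     = head-outs
      ; typed         = typed
      }
      where
      V : List Var
      V = varsᵠ (h ∷ B)

      inverse : ∀ {x} → x ∈ₗ V → var x ≡ ρ₂ x [ ρ₁ ]ᵗ
      inverse = []-injᵠ (h ∷ B) (trans ([]-idᵠ (h ∷ B))
        (trans (cong (λ c → head c ∷ body c) e₁) (⨟-termᵠ (h ∷ B))))

      renames : VarOn V ρ₂
      renames p = IsVar-[]⁻ (ρ₂ _) (_ , sym (inverse p))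

      var-[]⁻ : ∀ r {x} → vars r ⊆ V → x ∈ₗ V → r [ ρ₂ ]ᵗ ≡ ρ₂ x → r ≡ var x
      var-[]⁻ (var z)    r⊆ x∈ e =
        trans (inverse (r⊆ (here refl))) (trans (cong (_[ ρ₁ ]ᵗ) e) (sym (inverse x∈)))
      var-[]⁻ (app f ts) r⊆ x∈ e with trans e (proj₂ (renames x∈))
      ... | ()

      head-ins : ∀ i → IsVar (lookup (ins h) i) ⊎ (Flat (lookup (ins h) i) × BoundIn P (pred h) i)
      head-ins i with em {P = BoundIn P (pred h) i}
      ... | yes b = inj₂ (Flat-[]⁻ (lookup (ins h) i) (renames ∘ ∈-++⁺ˡ ∘ ∈-++⁺ˡ ∘ lookup-⊆ (ins h) i)
                            (subst Flat (lookup-[] (ins h) ρ₂ i) (proj₁ (bound i b))) , b)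
      ... | no  f = inj₁ (IsVar-[]⁻ (lookup (ins h) i) (subst IsVar (lookup-[] (ins h) ρ₂ i) (free i f)))

      head-outs : ∀ {i x} → BoundOut P (pred h) i → lookup (outs h) i ≡ var x →
                  FillsBoundIn P (outType (pred h) i) x h ⊎
                  ∃[ b ] (b ∈ₗ B × FillsBoundOut P (outType (pred h) i) x b)
      head-outs {i} {x} b e with ρ₂ x in ρ₂x | renames x∈V
        where
        x∈V : x ∈ₗ V
        x∈V = ∈-++⁺ˡ (∈-++⁺ʳ (inVars h) (lookup-varᵛ (outs h) i e))
      ... | _ | y , refl with fills i y b (trans (lookup-[] (outs h) ρ₂ i) (trans (cong (_[ ρ₂ ]ᵗ) e) ρ₂x))
      ... | inj₁ (j , b′ , same , e′) = inj₁ (j , b′ , same ,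
        var-[]⁻ (lookup (ins h) j) (∈-++⁺ˡ ∘ ∈-++⁺ˡ ∘ lookup-⊆ (ins h) j)
          (∈-++⁺ˡ (∈-++⁺ʳ (inVars h) (lookup-varᵛ (outs h) i e)))
          (trans (sym (lookup-[] (ins h) ρ₂ j)) (trans e′ (sym ρ₂x))))
      ... | inj₂ any with find (Any.map⁻ any)
      ... | d , d∈ , j , b′ , same , e′ = inj₂ (d , d∈ , j , b′ , same ,
        var-[]⁻ (lookup (outs d) j)
          (∈-++⁺ʳ (varsᵃ h) ∘ outVarsᵠ-⊆ B ∘ outVars-⊆ {B} d∈ ∘ lookup-⊆ (outs d) j)
          (∈-++⁺ˡ (∈-++⁺ʳ (inVars h) (lookup-varᵛ (outs h) i e)))
          (trans (sym (lookup-[] (outs d) ρ₂ j)) (trans e′ (sym ρ₂x))))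

      typed : ∀ σ → InTyped (h [ σ ]ᵃ) → ClauseChain (h [ σ ]ᵃ) (B [ σ ]ᵠ)
      typed σ = subst (λ c → InTyped (head c) → ClauseChain (head c) (body c)) instance-eq
        λ i → Chain⁺ (B [ ρ₂ ]ᵠ) (λ B₁ a B₂ e → typed₁ B₁ a B₂ e (ρ₁ ⨟ σ) i) , typed₂ (ρ₁ ⨟ σ) i
        where
        instance-eq : (h ⟵ B) [ ρ₂ ]ᶜ [ ρ₁ ⨟ σ ]ᶜ ≡ (h ⟵ B) [ σ ]ᶜ
        instance-eq = trans
          (cong₂ _⟵_ (sym (⨟-termᵃ (h [ ρ₂ ]ᵃ))) (sym (⨟-termᵠ (B [ ρ₂ ]ᵠ))))
          (cong (_[ σ ]ᶜ) (sym e₁))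

  nonvar-bound : ∀ a {j} → RobustOuts P a → ¬ IsVar (lookup (outs a) j) → BoundOut P (pred a) j
  nonvar-bound a {j} (free , _) n = em⇒dne em (n ∘ free j)

  outVars-split : ∀ Q₁ a Q₂ → outVarsᵠ (Q₁ ++ a ∷ Q₂) ≡ outVarsᵠ Q₁ ++ outVars a ++ outVarsᵠ Q₂
  outVars-split Q₁ a Q₂ = concatMap-++ outVars Q₁ (a ∷ Q₂)

  varsᵠ-++⁺ˡ : ∀ Q₁ {Q₂} → varsᵠ Q₁ ⊆ varsᵠ (Q₁ ++ Q₂)
  varsᵠ-++⁺ˡ Q₁ {Q₂} p = subst (_ ∈ₗ_) (sym (concatMap-++ varsᵃ Q₁ Q₂)) (∈-++⁺ˡ p)

  varsᵠ-++⁺ʳ : ∀ Q₁ {Q₂} → varsᵠ Q₂ ⊆ varsᵠ (Q₁ ++ Q₂)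
  varsᵠ-++⁺ʳ Q₁ {Q₂} p = subst (_ ∈ₗ_) (sym (concatMap-++ varsᵃ Q₁ Q₂)) (∈-++⁺ʳ (varsᵠ Q₁) p)

  varsᵠ-++⁻ : ∀ Q₁ {Q₂ x} → x ∈ₗ varsᵠ (Q₁ ++ Q₂) → x ∈ₗ varsᵠ Q₁ ⊎ x ∈ₗ varsᵠ Q₂
  varsᵠ-++⁻ Q₁ {Q₂} p = ∈-++⁻ (varsᵠ Q₁) (subst (_ ∈ₗ_) (concatMap-++ varsᵃ Q₁ Q₂) p)

  []ˡ-fixed : ∀ xs {σ} → AgreeOn xs σ var → xs [ σ ]ˡ ≡ xs
  []ˡ-fixed []       _ = refl
  []ˡ-fixed (x ∷ xs) h = cong₂ _++_ (cong vars (h (here refl))) ([]ˡ-fixed xs (h ∘ there))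

  occurs-head : ∀ {c p v u B} → c ∈ₗ clauses P → Variant c (atom p v u ⟵ B) → OccursIn p P
  occurs-head c∈P ((_ , e) , _) = Any.map (λ { refl → here (sym (cong (pred ∘ head) e)) }) c∈P

  module _ {p} {s v : Vec Term (inArity p)} {t u : Vec Term (outArity p)} {before after B : Query}
    (nice  : Nice (before ++ atom p s t ∷ after))
    (good  : GoodClause (atom p v u) B)
    (apart : Disjoint (varsᶜ (atom p v u ⟵ B)) (varsᵠ (before ++ atom p s t ∷ after)))
    where
    open Nice nice
    open GoodClause good

    private
      a h : Atom
      a = atom p s t
      h = atom p v u

      Q : Query
      Q = before ++ a ∷ after

      linear-parts = Unique-++⁻ (outVarsᵠ before) (subst Unique (outVars-split before a after) linear)
      linear-rest  = Unique-++⁻ (outVars a) (proj₁ (proj₂ linear-parts))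
      moded-parts  = Moded-++⁻ before moded

      a-robust : RobustOuts P a
      a-robust = All.head (All.++⁻ʳ before robust)

      selected-disjoint : Disjoint (varsᵛ s) (varsᵛ t ++ outVarsᵠ after)
      selected-disjoint = proj₁ (proj₁ (proj₂ moded-parts))

      a-vars : varsᵃ a ⊆ varsᵠ Q
      a-vars p = varsᵠ-++⁺ʳ before (∈-++⁺ˡ p)

      after-vars : varsᵠ after ⊆ varsᵠ Q
      after-vars p = varsᵠ-++⁺ʳ before (∈-++⁺ʳ (varsᵃ a) p)

    opaque
      -- Selectability makes the selected atom non-variable in its bound input positions, the only
      -- ones where the head may be non-variable. For a head variable facing a non-variable output,
      -- robust typing of the clause names a bound position that it fills; if it occurs in the head
      -- inputs, moding excludes the body, so that position is an input one.
      resolve : ∀ {δ} → OccursIn p P → Selectable P a → Unifier a h δ → ∃[ η ] ConsumingMGU s t v u η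
      resolve occurs sel unif = consuming-mgu
        (λ (p , q) → apart (∈-++⁺ˡ p , a-vars q))
        (proj₁ linear-rest)
        (λ (p , q) → selected-disjoint (p , ∈-++⁺ˡ q))
        head-linear
        in-match
        (RobustOuts-flat a a-robust)
        out-in
        unif
        where
        bound-nonvar : ∀ i → BoundIn P p i → ¬ IsVar (lookup s i)
        bound-nonvar = proj₁ (selectability a occurs (proj₁ a-robust)) sel

        in-match : ∀ i → IsVar (lookup v i) ⊎ (Flat (lookup v i) × ¬ IsVar (lookup s i))
        in-match i = Sum.map₂ (λ (fl , b) → fl , bound-nonvar i b) (head-ins i)

        out-in : ∀ {j x} → ¬ IsVar (lookup t j) → lookup u j ≡ var x → x ∈ₗ varsᵛ v →
                 ∃[ i ] (lookup v i ≡ var x × ¬ IsVar (lookup s i))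
        out-in n uj x∈v with head-outs (nonvar-bound a a-robust n) uj
        ... | inj₁ (i , b , _ , e)           = i , e , bound-nonvar i b
        ... | inj₂ (b , b∈ , k , _ , _ , e) =
          contradiction (x∈v , outVars-⊆ {B} b∈ (lookup-varᵛ (outs b) k e)) head-disjoint

    module Resolvent {η} (mgu : ConsumingMGU s t v u η) where
      open ConsumingMGU mgu

      fixes-query : ∀ {x} → x ∈ₗ varsᵠ Q → x ∉ₗ varsᵛ t → η x ≡ var x
      fixes-query x∈ x∉t = fixes x∉t λ x∈h → apart (∈-++⁺ˡ x∈h , x∈)

      -- Earlier inputs avoid the selected outputs by moding, earlier outputs avoid them by
      -- linearity.
      fixes-before : AgreeOn (varsᵠ before) η var
      fixes-before x∈ = fixes-query (varsᵠ-++⁺ˡ before x∈) λ x∈t → case varsᵠ-cases before x∈ of λ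
        { (inj₁ q) → proj₂ (proj₂ moded-parts) (q , ∈-++⁺ˡ x∈t)
        ; (inj₂ q) → proj₂ (proj₂ linear-parts) (q , ∈-++⁺ˡ x∈t) }

      fixes-after : AgreeOn (outVarsᵠ after) η var
      fixes-after x∈ = fixes-query (after-vars (outVarsᵠ-⊆ after x∈)) λ x∈t →
        proj₂ (proj₂ linear-rest) (x∈t , x∈)

      body-link : ∀ {x} → x ∈ₗ outVarsᵠ B → η x ≡ var x ⊎
                  ∃[ j ] (lookup u j ≡ var x × η x ≡ lookup t j × ¬ IsVar (lookup t j))
      body-link x∈ = link (λ x∈v → head-disjoint (x∈v , x∈))
        λ x∈t → apart (∈-++⁺ʳ (varsᵃ h) (outVarsᵠ-⊆ B x∈) , a-vars (∈-++⁺ʳ (varsᵛ s) x∈t))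

      linked-∈ : ∀ {x y j} → η x ≡ lookup t j → y ∈ₗ vars (η x) → y ∈ₗ vars (lookup t j)
      linked-∈ {x} e q = vars-≡ (η x) e q

      linked-t : ∀ {x y j} → η x ≡ lookup t j → y ∈ₗ vars (η x) → y ∈ₗ varsᵛ t
      linked-t {j = j} e q = lookup-⊆ t j (linked-∈ e q)

      fixed-∈ : ∀ {x y} → η x ≡ var x → y ∈ₗ vars (η x) → y ≡ x
      fixed-∈ {x} e q = case vars-≡ (η x) e q of λ { (here e′) → e′ }

      body-out-vars : ∀ {x y} → x ∈ₗ outVarsᵠ B → y ∈ₗ vars (η x) → y ∈ₗ varsᵛ t ⊎ y ∈ₗ outVarsᵠ B
      body-out-vars x∈ q with body-link x∈
      ... | inj₁ e               = inj₂ (subst (_∈ₗ outVarsᵠ B) (sym (fixed-∈ e q)) x∈)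
      ... | inj₂ (j , _ , e , _) = inj₁ (linked-t e q)

      body∉query : ∀ {y} → y ∈ₗ varsᵠ B → y ∉ₗ varsᵠ Q
      body∉query p q = apart (∈-++⁺ʳ (varsᵃ h) p , q)

      -- Distinct variables linked to output positions of the head are linked to
      -- distinct positions, where the linear vector t has disjoint terms.
      separated : ∀ {z x} → z ∈ₗ varsᵠ B → x ∈ₗ outVarsᵠ B → z ≢ x → Disjoint (vars (η z)) (vars (η x))
      separated {z} {x} z∈ x∈ z≢x (p , q) with z ∈? varsᵛ v
      separated {z} {x} z∈ x∈ z≢x (p , q) | yes z∈v with body-out-vars x∈ q
      ... | inj₁ q′ = selected-disjoint (head-in z∈v p , ∈-++⁺ˡ q′)
      ... | inj₂ q′ = body∉query (outVarsᵠ-⊆ B q′) (a-vars (∈-++⁺ˡ (head-in z∈v p)))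
      separated {z} {x} z∈ x∈ z≢x (p , q) | no z∉v
        with link z∉v (λ z∈t → body∉query z∈ (a-vars (∈-++⁺ʳ (varsᵛ s) z∈t))) | body-link x∈
      ... | inj₁ e | inj₁ e′ = z≢x (trans (sym (fixed-∈ e p)) (fixed-∈ e′ q))
      ... | inj₁ e | inj₂ (_ , _ , e′ , _) with fixed-∈ e p
      ... | refl = body∉query z∈ (a-vars (∈-++⁺ʳ (varsᵛ s) (linked-t e′ q)))
      separated {z} {x} z∈ x∈ z≢x (p , q) | no z∉v | inj₂ (_ , _ , e , _) | inj₁ e′ with fixed-∈ e′ q
      ... | refl = body∉query (outVarsᵠ-⊆ B x∈) (a-vars (∈-++⁺ʳ (varsᵛ s) (linked-t e p)))
      separated {z} {x} z∈ x∈ z≢x (p , q) | no z∉v | inj₂ (j , uj , e , _) | inj₂ (k , uk , e′ , _)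
        with same-position t (proj₁ linear-rest) (linked-∈ e p) (linked-∈ e′ q)
      ... | refl with trans (sym uj) uk
      ... | refl = z≢x refl

      resolvent : Query
      resolvent = (before ++ B ++ after) [ η ]ᵠ

      resolvent-split : resolvent ≡ before ++ B [ η ]ᵠ ++ after [ η ]ᵠ
      resolvent-split = trans ([]-++ before (B ++ after) η)
        (cong₂ _++_ (trans ([]-congᵠ before fixes-before) ([]-idᵠ before)) ([]-++ B after η))

      after-outs : outVarsᵠ (after [ η ]ᵠ) ≡ outVarsᵠ after
      after-outs = trans (outVars-[]ᵠ after η) ([]ˡ-fixed (outVarsᵠ after) fixes-after)

      resolvent-outs : outVarsᵠ resolvent ≡ outVarsᵠ before ++ outVarsᵠ (B [ η ]ᵠ) ++ outVarsᵠ after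
      resolvent-outs = trans (cong outVarsᵠ resolvent-split)
        (trans (concatMap-++ outVars before _)
          (cong (outVarsᵠ before ++_)
            (trans (concatMap-++ outVars (B [ η ]ᵠ) _) (cong (outVarsᵠ (B [ η ]ᵠ) ++_) after-outs))))

      body-outs-∈ : ∀ {y} → y ∈ₗ outVarsᵠ (B [ η ]ᵠ) → y ∈ₗ varsᵛ t ⊎ y ∈ₗ outVarsᵠ B
      body-outs-∈ q with ∈-[]ˡ⁻ η (outVars-[]ᵠ B η) q
      ... | x , x∈ , q′ = body-out-vars x∈ q′

      resolvent-outs-∈ : ∀ {y} → y ∈ₗ outVarsᵠ resolvent → y ∈ₗ outVarsᵠ Q ⊎ y ∈ₗ varsᵠ B
      resolvent-outs-∈ {y} q with ∈-++⁻ (outVarsᵠ before) (subst (y ∈ₗ_) resolvent-outs q)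
      ... | inj₁ r = inj₁ (subst (y ∈ₗ_) (sym (outVars-split before a after)) (∈-++⁺ˡ r))
      ... | inj₂ r with ∈-++⁻ (outVarsᵠ (B [ η ]ᵠ)) r
      ... | inj₂ r′ = inj₁ (subst (y ∈ₗ_) (sym (outVars-split before a after))
                        (∈-++⁺ʳ (outVarsᵠ before) (∈-++⁺ʳ (varsᵛ t) r′)))
      ... | inj₁ r′ with body-outs-∈ r′
      ... | inj₁ w = inj₁ (subst (y ∈ₗ_) (sym (outVars-split before a after))
                        (∈-++⁺ʳ (outVarsᵠ before) (∈-++⁺ˡ w)))
      ... | inj₂ w = inj₂ (outVarsᵠ-⊆ B w)

      Unique-η : ∀ {x} → x ∈ₗ outVarsᵠ B → Unique (vars (η x))
      Unique-η x∈ with body-link x∈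
      ... | inj₁ e               = subst (Unique ∘ vars) (sym e) ([] ∷ [])
      ... | inj₂ (j , _ , e , _) = subst (Unique ∘ vars) (sym e) (Unique-lookup t j (proj₁ linear-rest))

      resolvent-linear : Unique (outVarsᵠ resolvent)
      resolvent-linear = subst Unique (sym resolvent-outs)
        (Unique-splice (outVarsᵠ before) (subst Unique (outVars-split before a after) linear)
          (subst Unique (sym (outVars-[]ᵠ B η))
            (Unique-concatMap⁺ (Nice.linear body-nice) Unique-η
              (λ p q → separated (outVarsᵠ-⊆ B p) q)))
          λ q → Sum.map₂ (λ r →
            (λ w → body∉query (outVarsᵠ-⊆ B r) (varsᵠ-++⁺ˡ before (outVarsᵠ-⊆ before w))) ,
            (λ w → body∉query (outVarsᵠ-⊆ B r) (after-vars (outVarsᵠ-⊆ after w)))) (body-outs-∈ q))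

      after-out∉scope : ∀ {y} → y ∈ₗ outVarsᵠ after → y ∉ₗ varsᵃ a ++ varsᵃ h
      after-out∉scope {y} y∈ q with ∈-++⁻ (varsᵃ a) q
      ... | inj₂ r = apart (∈-++⁺ˡ r , after-vars (outVarsᵠ-⊆ after y∈))
      ... | inj₁ r with ∈-++⁻ (varsᵛ s) r
      ... | inj₁ r′ = selected-disjoint (r′ , ∈-++⁺ʳ (varsᵛ t) y∈)
      ... | inj₂ r′ = proj₂ (proj₂ linear-rest) (r′ , y∈)

      after-moded : Moded (after [ η ]ᵠ)
      after-moded = Moded-[]⁺ after (proj₂ (proj₁ (proj₂ moded-parts))) sep
        where
        sep : ∀ {z x} → z ∈ₗ inVarsᵠ after → x ∈ₗ outVarsᵠ after → z ≢ x → Disjoint (vars (η z)) (vars (η x))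
        sep {z} z∈ x∈ z≢x (p , q) with fixed-∈ (fixes-after x∈) q
        ... | refl with scope z p
        ... | here refl = z≢x refl
        ... | there r   = after-out∉scope x∈ r

      body-after : Disjoint (inVarsᵠ (B [ η ]ᵠ)) (outVarsᵠ (after [ η ]ᵠ))
      body-after (p , q) with ∈-[]ˡ⁻ η (inVars-[]ᵠ B η) p | subst (_ ∈ₗ_) after-outs q
      ... | z , z∈ , r | q′ with scope z r
      ... | here refl = body∉query (inVarsᵠ-⊆ B z∈) (after-vars (outVarsᵠ-⊆ after q′))
      ... | there r′  = after-out∉scope q′ r′

      before-rest : Disjoint (inVarsᵠ before) (outVarsᵠ (B [ η ]ᵠ ++ after [ η ]ᵠ))
      before-rest (p , q) with ∈-++⁻ (outVarsᵠ (B [ η ]ᵠ)) (subst (_ ∈ₗ_) (concatMap-++ outVars (B [ η ]ᵠ) _) q)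
      ... | inj₂ r = proj₂ (proj₂ moded-parts) (p , ∈-++⁺ʳ (varsᵛ t) (subst (_ ∈ₗ_) after-outs r))
      ... | inj₁ r with body-outs-∈ r
      ... | inj₁ w = proj₂ (proj₂ moded-parts) (p , ∈-++⁺ˡ w)
      ... | inj₂ w = body∉query (outVarsᵠ-⊆ B w) (varsᵠ-++⁺ˡ before (inVarsᵠ-⊆ before p))

      resolvent-moded : Moded resolvent
      resolvent-moded = subst Moded (sym resolvent-split)
        (Moded-++⁺ before (proj₁ moded-parts)
          (Moded-++⁺ (B [ η ]ᵠ)
            (Moded-[]⁺ B (Nice.moded body-nice) (λ p q → separated (inVarsᵠ-⊆ B p) q))
            after-moded body-after)
          before-rest)

      after-robust : All (RobustOuts P) (after [ η ]ᵠ)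
      after-robust = go after fixes-after (All.tail (All.++⁻ʳ before robust))
        where
        go : ∀ Q → AgreeOn (outVarsᵠ Q) η var → All (RobustOuts P) Q → All (RobustOuts P) (Q [ η ]ᵠ)
        go []      _ []                    = []
        go (b ∷ Q) f ((free , bound) ∷ rs) =
          subst Robust′ (sym (trans ([]-congᵛ (outs b) (f ∘ ∈-++⁺ˡ)) ([]-idᵛ (outs b)))) (free , bound)
          ∷ go Q (f ∘ ∈-++⁺ʳ (outVars b)) rs
          where
          Robust′ : Vec Term (outArity (pred b)) → Set
          Robust′ ts = RobustOuts P (atom (pred b) (ins b [ η ]ᵛ) ts)

      Linked : Term → Set
      Linked r = ∃[ x ] (x ∈ₗ vars r × ∃[ j ] (lookup u j ≡ var x × η x ≡ lookup t j × ¬ IsVar (lookup t j)))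

      -- A linked variable x fills a bound output position of B of the same type, and by
      -- linearity this is the only output position of B where x occurs.
      linked-position : ∀ {b i} → b ∈ₗ B → Linked (lookup (outs b) i) → BoundOut P (pred b) i ×
        Flat (lookup (outs b) i [ η ]ᵗ) × TypeConsistent (outType (pred b) i) (lookup (outs b) i [ η ]ᵗ)
      linked-position {b} {i} b∈ (x , x∈ , j , uj , e , n)
        with nonvar-bound a a-robust n
      ... | bnd with head-outs bnd uj
      ... | inj₁ (k , _ , _ , e′) =
        contradiction (lookup-varᵛ v k e′ , outVars-⊆ {B} b∈ (lookup-⊆ (outs b) i x∈)) head-disjoint
      ... | inj₂ (d , d∈ , k , bnd′ , (_ , same) , e′)
        with same-out-position {B} (Nice.linear body-nice) b∈ d∈ x∈ (vars-≡ (var x) (sym e′) (here refl))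
      ... | refl = bnd′ , subst Flat (sym r≡) (RobustOuts-flat a a-robust j) ,
                   let (σ , tc) = proj₂ (proj₂ a-robust j bnd)
                   in σ , same (subst (λ r → r [ σ ]ᵗ ∈ ⟦ outType p j ⟧) (sym r≡) tc)
        where
        r≡ : lookup (outs d) k [ η ]ᵗ ≡ lookup t j
        r≡ = trans (cong (_[ η ]ᵗ) e′) e

      unlinked : ∀ {b i} → b ∈ₗ B → ¬ Linked (lookup (outs b) i) → lookup (outs b) i [ η ]ᵗ ≡ lookup (outs b) i
      unlinked {b} {i} b∈ n = trans ([]-congᵗ (lookup (outs b) i) fixed) ([]-idᵗ _)
        where
        fixed : AgreeOn (vars (lookup (outs b) i)) η var
        fixed {x} x∈ with body-link (outVars-⊆ {B} b∈ (lookup-⊆ (outs b) i x∈))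
        ... | inj₁ e = e
        ... | inj₂ l = contradiction (x , x∈ , l) n

      body-robust : All (RobustOuts P) (B [ η ]ᵠ)
      body-robust = All.map⁺ (All.tabulate robust-instance)
        where
        robust-instance : ∀ {b} → b ∈ₗ B → RobustOuts P (b [ η ]ᵃ)
        robust-instance {b} b∈ = free′ , bound′
          where
          b-robust = All.lookup (Nice.robust body-nice) b∈
          free′ : ∀ i → FreeOut P (pred b) i → IsVar (lookup (outs b [ η ]ᵛ) i)
          free′ i f with em {P = Linked (lookup (outs b) i)}
          ... | yes l = contradiction (proj₁ (linked-position b∈ l)) f
          ... | no  n = subst IsVar (sym (trans (lookup-[] (outs b) η i) (unlinked b∈ n))) (proj₁ b-robust i f)
          bound′ : ∀ i → BoundOut P (pred b) i → Flat (lookup (outs b [ η ]ᵛ) i) ×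
                   TypeConsistent (outType (pred b) i) (lookup (outs b [ η ]ᵛ) i)
          bound′ i bnd = subst (λ r → Flat r × TypeConsistent (outType (pred b) i) r)
                               (sym (lookup-[] (outs b) η i)) (consistent)
            where
            consistent : Flat (lookup (outs b) i [ η ]ᵗ) ×
                         TypeConsistent (outType (pred b) i) (lookup (outs b) i [ η ]ᵗ)
            consistent with em {P = Linked (lookup (outs b) i)}
            ... | yes l = proj₂ (linked-position b∈ l)
            ... | no  n = subst (λ r → Flat r × TypeConsistent (outType (pred b) i) r)
                                (sym (unlinked b∈ n)) (proj₂ b-robust i bnd)

      resolvent-nice : Nice resolvent
      resolvent-nice = record
        { linear = resolvent-linear
        ; moded  = resolvent-moded
        ; robust = subst (All (RobustOuts P)) (sym resolvent-split)
                     (All.++⁺ (All.++⁻ˡ before robust) (All.++⁺ body-robust after-robust))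
        }

-- Replaying derivations on more instantiated queries.

module Simulation (em : ExcludedMiddle 0ℓ) (S : Signature) (τ : Syntax.Typing S) (P : Syntax.Program S)
  (robust-program : Typed.RobustlyTypedProgram S τ P)
  (input-linear   : Syntax.InputLinear S P)
  (selectability  : Typed.InputSelectability S τ P)
  where
  open Syntax S
  open Typing τ
  open Typed S τ
  open Substitutions S
  open Resolution em S
  open RobustTyping em S τ
  open RobustQueries P
  open Steps em S τ P robust-program input-linear selectability

  infix 4 _⇒_

  -- Delay-respecting resolution restricted to canonical mgus. Steps with arbitrary mgus reach this
  -- relation only through `simulate`.
  record _⇒_ (Q Q′ : Query) : Set where
    field
      {p}          : Pred
      before after : Query
      s v          : Vec Term (inArity p)
      t u          : Vec Term (outArity p)
      B            : Query
      split        : Q ≡ before ++ atom p s t ∷ after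
      clause       : Clause
      clause∈P     : clause ∈ₗ clauses P
      variant      : Variant clause (atom p v u ⟵ B)
      apart        : Disjoint (varsᶜ (atom p v u ⟵ B)) (varsᵠ Q)
      η            : Subst
      mgu          : ConsumingMGU s t v u η
      selectable   : Selectable P (atom p s t)
      result       : Q′ ≡ (before ++ B ++ after) [ η ]ᵠ

  module _ {Q Q′ : Query} (step : Q ⇒ Q′) where
    open _⇒_ step

    toStep : Step P Q Q′
    toStep = record
      { before = before ; selected = atom p s t ; after = after ; split = split
      ; clause = clause ; clause∈P = clause∈P ; renamed = atom p v u ⟵ B ; variant = variant
      ; apart = apart ; θ = η
      ; mgu = ConsumingMGU.unifies mgu , λ δ e → δ , ConsumingMGU.universal mgu δ e
      ; result = result }

    toStep-selectable : Selectable P (selected toStep)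
    toStep-selectable = selectable

  ⇒-nice : ∀ {Q Q′} → Nice Q → Q ⇒ Q′ → Nice Q′
  ⇒-nice n record { before = before ; split = refl ; clause∈P = c∈P ; variant = var′
                  ; apart = apart ; mgu = mgu ; result = refl } =
    Resolvent.resolvent-nice {before = before} n (variant-good c∈P var′) apart mgu

  []-resolvent : ∀ Q₁ Q₂ Q₃ σ → (Q₁ ++ Q₂ ++ Q₃) [ σ ]ᵠ ≡ Q₁ [ σ ]ᵠ ++ Q₂ [ σ ]ᵠ ++ Q₃ [ σ ]ᵠ
  []-resolvent Q₁ Q₂ Q₃ σ = trans ([]-++ Q₁ (Q₂ ++ Q₃) σ) (cong (Q₁ [ σ ]ᵠ ++_) ([]-++ Q₂ Q₃ σ))

  unifies-⨟ : ∀ a h {η σ} → Unifier a h η → Unifier a h (η ⨟ σ)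
  unifies-⨟ a h e = trans (sym (⨟-termᵃ a)) (trans (cong (_[ _ ]ᵃ) e) (⨟-termᵃ h))

  step-typed : ∀ {a h B η} σ → GoodClause h B → Unifier a h η →
               InTyped (a [ η ⨟ σ ]ᵃ) → ClauseChain (a [ η ⨟ σ ]ᵃ) (B [ η ⨟ σ ]ᵠ)
  step-typed {a} {h} {B} {η} σ good e i =
    subst (λ b → ClauseChain b (B [ η ⨟ σ ]ᵠ)) (sym e′) (GoodClause.typed good (η ⨟ σ) (subst InTyped e′ i))
    where
    e′ : Unifier a h (η ⨟ σ)
    e′ = unifies-⨟ a h e

  -- An instance of the resolvent by `σ` is compared with the instance of the query by `η ⨟ σ`,
  -- where selected atom and clause head coincide.
  ⇒-RT : ∀ {Q Q′} → RT Q → Q ⇒ Q′ → RT Q′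
  ⇒-RT rt step@(record { before = before ; after = after ; B = B ; split = refl ; clause∈P = c∈P
                        ; variant = var′ ; η = η ; mgu = mgu ; result = refl }) = record
    { nice  = ⇒-nice nice step
    ; chain = λ σ → subst Chain
        (sym (trans (⨟-termᵠ (before ++ B ++ after)) ([]-resolvent before B after (η ⨟ σ))))
        (Chain-resolve (before [ η ⨟ σ ]ᵠ) (subst Chain ([]-++ before _ (η ⨟ σ)) (chain (η ⨟ σ)))
          (step-typed σ (variant-good c∈P var′) (ConsumingMGU.unifies mgu)))
    }
    where open RT rt

  -- A term with a variable instance is itself a variable, so instantiation never blocks an atom.
  selectable-[] : ∀ a {σ} → Selectable P a → Selectable P (a [ σ ]ᵃ)
  selectable-[] a {σ} sel blocked = sel (Any.map
    (λ (i , o) → (λ k e → IsVar-[]⁻ (lookup (ins a) k) (subst IsVar (lookup-[] (ins a) σ k) (i k e)))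
               , (λ k e → IsVar-[]⁻ (lookup (outs a) k) (subst IsVar (lookup-[] (outs a) σ k) (o k e)))) blocked)

  opaque
    freshness-bound : List Var → ℕ
    freshness-bound xs = suc (max 0 xs)

    <-freshness-bound : ∀ {xs x} → x ∈ₗ xs → x < freshness-bound xs
    <-freshness-bound {xs} x∈ = s≤s (All.lookup (xs≤max 0 xs) x∈)

  shift unshift : ℕ → Subst
  shift   n x = var (n + x)
  unshift n x = var (x ∸ n)

  shift-≤ : ∀ n xs {ys} → ys ≡ xs [ shift n ]ˡ → ∀ {w} → w ∈ₗ ys → n ≤ w
  shift-≤ n xs e q with ∈-[]ˡ⁻ (shift n) {xs} e q
  ... | x , _ , here refl = m≤m+n n x

  ⨟-termᶜ : ∀ c {σ δ} → c [ σ ]ᶜ [ δ ]ᶜ ≡ c [ σ ⨟ δ ]ᶜ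
  ⨟-termᶜ (h ⟵ B) = cong₂ _⟵_ (⨟-termᵃ h) (⨟-termᵠ B)

  variant-shift : ∀ {c d} n → Variant c d → Variant c (d [ shift n ]ᶜ)
  variant-shift {c} {d} n ((ρ₁ , e₁) , (ρ₂ , e₂)) =
    (ρ₁ ⨟ shift n , trans (cong (_[ shift n ]ᶜ) e₁) (⨟-termᶜ c)) ,
    (unshift n ⨟ ρ₂ , trans e₂ (trans
      (cong₂ _⟵_ ([]-congᵃ (head d) (λ _ → sym (cong ρ₂ (m+n∸m≡n n _))))
                 ([]-congᵠ (body d) (λ _ → sym (cong ρ₂ (m+n∸m≡n n _)))))
      (sym (⨟-termᶜ d))))

  []-factor : ∀ Q {Q′ θ σ δ η} → (∀ x → (δ ⨟ η) x ≡ θ x [ σ ]ᵗ) → Q [ δ ]ᵠ ≡ Q′ → Q [ θ ]ᵠ [ σ ]ᵠ ≡ Q′ [ η ]ᵠ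
  []-factor Q e refl = trans (⨟-termᵠ Q) (trans ([]-congᵠ Q (λ {x} _ → sym (e x))) (sym (⨟-termᵠ Q)))

  -- `fresh` and `agrees` control the variables shared with a part of the query outside `G`: the
  -- copy takes its clause variables from `N` upwards, and a value of `κ` that avoids these and the
  -- outputs of the copy is preserved.
  record Simulates {G G′} (step : Step P G G′) (κ : Subst) (N : ℕ) : Set where
    field
      κ′        : Subst
      simulated : G [ κ ]ᵠ ⇒ G′ [ κ′ ]ᵠ
      renames   : VarOn (outVarsᵠ G′) κ′
      fresh     : ∀ {w} → w ∈ₗ outVarsᵠ (G′ [ κ′ ]ᵠ) → w ∈ₗ outVarsᵠ (G [ κ ]ᵠ) ⊎ N ≤ w
      agrees    : ∀ {x} → x ∉ₗ varsᶜ (Step.renamed step) →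
                  (∀ {w} → w ∈ₗ vars (κ x) → w ∉ₗ outVarsᵠ (G [ κ ]ᵠ) × w < N) →
                  Step.θ step x [ κ′ ]ᵗ ≡ κ x

  -- Since κ only renames the output variables of G, the clause head that unifies with
  -- the selected atom a also unifies with its instance under κ: input selectability
  -- makes the head match the inputs of a, and κ creates no new function symbols in
  -- the outputs of a.
  module _ {p} {s v : Vec Term (inArity p)} {t u : Vec Term (outArity p)} {before after B : Query} {c : Clause}
    {κ θ : Subst} (N : ℕ)
    (sel     : Selectable P (atom p s t))
    (κ-renames : VarOn (outVarsᵠ (before ++ atom p s t ∷ after)) κ)
    (niceκ   : Nice ((before ++ atom p s t ∷ after) [ κ ]ᵠ))
    (c∈P     : c ∈ₗ clauses P)
    (variant : Variant c (atom p v u ⟵ B))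
    (apart   : Disjoint (varsᶜ (atom p v u ⟵ B)) (varsᵠ (before ++ atom p s t ∷ after)))
    (mgu     : MGU (atom p s t) (atom p v u) θ)
    where

    private
      a h : Atom
      a = atom p s t
      h = atom p v u

      G Gκ R : Query
      G  = before ++ a ∷ after
      Gκ = before [ κ ]ᵠ ++ a [ κ ]ᵃ ∷ after [ κ ]ᵠ
      R  = before ++ B ++ after

      d : Clause
      d = h ⟵ B

      splitκ : G [ κ ]ᵠ ≡ Gκ
      splitκ = []-++ before (a ∷ after) κ

      niceκ′ : Nice Gκ
      niceκ′ = subst Nice splitκ niceκ

      n : ℕ
      n = N ⊔ freshness-bound (varsᵠ Gκ)

      N≤n : N ≤ n
      N≤n = m≤m⊔n N _

      <n : ∀ {w} → w ∈ₗ varsᵠ Gκ → w < n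
      <n q = <-≤-trans (<-freshness-bound q) (m≤n⊔m N _)

      ρ : Subst
      ρ = shift n

      n≤ : ∀ {w} → w ∈ₗ varsᶜ (d [ ρ ]ᶜ) → n ≤ w
      n≤ = shift-≤ n (varsᵠ (h ∷ B)) (vars-[]ᵠ (h ∷ B) ρ)

      apartκ : Disjoint (varsᶜ (d [ ρ ]ᶜ)) (varsᵠ Gκ)
      apartκ (q , r) = <⇒≱ (<n r) (n≤ q)

      -- Carries the original query and the original clause to their copies at once; they share no
      -- variables.
      κ̂ : Subst
      κ̂ = upd (varsᶜ d) ρ κ

      κ̂-query : ∀ {x} → x ∈ₗ varsᵠ G → κ̂ x ≡ κ x
      κ̂-query q = upd-∉ λ r → apart (r , q)

      κ̂-clause : ∀ {x} → x ∈ₗ varsᶜ d → κ̂ x ≡ ρ x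
      κ̂-clause = upd-∈

      a⊆G : varsᵃ a ⊆ varsᵠ G
      a⊆G q = varsᵠ-++⁺ʳ before (∈-++⁺ˡ q)

      before⊆G : varsᵠ before ⊆ varsᵠ G
      before⊆G = varsᵠ-++⁺ˡ before

      after⊆G : varsᵠ after ⊆ varsᵠ G
      after⊆G q = varsᵠ-++⁺ʳ before {a ∷ after} (∈-++⁺ʳ (varsᵃ a) q)

      a⊆Gκ : varsᵃ (a [ κ ]ᵃ) ⊆ varsᵠ Gκ
      a⊆Gκ q = varsᵠ-++⁺ʳ (before [ κ ]ᵠ) (∈-++⁺ˡ q)

      aκ̂ : a [ κ̂ ]ᵃ ≡ a [ κ ]ᵃ
      aκ̂ = []-congᵃ a (κ̂-query ∘ a⊆G)

      hκ̂ : h [ κ̂ ]ᵃ ≡ h [ ρ ]ᵃ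
      hκ̂ = []-congᵃ h (κ̂-clause ∘ ∈-++⁺ˡ)

      nice : Nice G
      nice = Nice-[]⁻ G κ-renames niceκ

      good : GoodClause h B
      good = variant-good c∈P variant

      goodκ : GoodClause (h [ ρ ]ᵃ) (B [ ρ ]ᵠ)
      goodκ = variant-good c∈P (variant-shift n variant)

      occurs : OccursIn p P
      occurs = occurs-head c∈P variant

      -- The given `θ` may rename the inputs of `a`. The canonical mgu fixes them, as `unifierκ-s`
      -- requires.
      η₀ : Subst
      η₀ = proj₁ (resolve nice good apart occurs sel (proj₁ mgu))

      mgu₀ : ConsumingMGU s t v u η₀
      mgu₀ = proj₂ (resolve nice good apart occurs sel (proj₁ mgu))

      linear-a : ∀ Q₁ {b Q₂} → Nice (Q₁ ++ b ∷ Q₂) → Unique (outVars b)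
      linear-a Q₁ {b} {Q₂} n = proj₁ (Unique-++⁻ (outVars b) (Nice.linear (proj₂ (Nice-++⁻ Q₁ n))))

      moded-a : ∀ Q₁ {b Q₂} → Nice (Q₁ ++ b ∷ Q₂) → Disjoint (inVars b) (outVars b)
      moded-a Q₁ {b} n (q , r) = proj₁ (Nice.moded (proj₂ (Nice-++⁻ Q₁ n))) (q , ∈-++⁺ˡ r)

      t-var : ∀ {j y} → lookup t j ≡ var y → IsVar (lookup (t [ κ ]ᵛ) j)
      t-var {j} {y} e = subst IsVar (sym (trans (lookup-[] t κ j) (cong (_[ κ ]ᵗ) e)))
        (κ-renames (subst (y ∈ₗ_) (sym (outVars-split before a after))
          (∈-++⁺ʳ (outVarsᵠ before) (∈-++⁺ˡ (lookup-varᵛ t j e)))))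

      t-shape : ∀ j → HasShape (lookup (t [ κ ]ᵛ) j) (lookup (t [ η₀ ]ᵛ [ κ̂ ]ᵛ) j)
      t-shape j {f} e = subst (λ r → ∃[ rs ] r ≡ app f rs)
        (sym (trans (lookup-[] (t [ η₀ ]ᵛ) κ̂ j) (cong (_[ κ̂ ]ᵗ) (lookup-[] t η₀ j))))
        (shape (lookup t j) refl)
        where
        shape : ∀ r → lookup t j ≡ r → ∃[ rs ] lookup t j [ η₀ ]ᵗ [ κ̂ ]ᵗ ≡ app f rs
        shape (var y)    e′ = case trans (sym (proj₂ (t-var e′))) e of λ ()
        shape (app g us) e′ with app-functor
          (trans (sym (cong (_[ κ ]ᵗ) e′)) (trans (sym (lookup-[] t κ j)) e))
        ... | refl = us [ η₀ ]ᵛ [ κ̂ ]ᵛ , cong (λ r → r [ η₀ ]ᵗ [ κ̂ ]ᵗ) e′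

      opaque
        match : ∃[ μ ] t [ κ ]ᵛ [ μ ]ᵛ ≡ t [ η₀ ]ᵛ [ κ̂ ]ᵛ
        match = match-linear (t [ κ ]ᵛ) (t [ η₀ ]ᵛ [ κ̂ ]ᵛ) (linear-a (before [ κ ]ᵠ) niceκ′)
          (RobustOuts-flat (a [ κ ]ᵃ) (All.head (All.++⁻ʳ (before [ κ ]ᵠ) (Nice.robust niceκ′)))) t-shape

      μ unifierκ : Subst
      μ = proj₁ match
      -- Every piece aims at the image under `η₀` followed by `κ̂`: output variables of the copied
      -- atom get there by matching, shifted clause variables by undoing the shift first, and the
      -- copied inputs are already there.
      unifierκ = upd (varsᵛ (t [ κ ]ᵛ)) μ (upd (varsᶜ (d [ ρ ]ᶜ)) (λ w → η₀ (w ∸ n) [ κ̂ ]ᵗ) var)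

      unifierκ-s : s [ κ ]ᵛ [ unifierκ ]ᵛ ≡ s [ η₀ ]ᵛ [ κ̂ ]ᵛ
      unifierκ-s = trans
        (trans ([]-congᵛ (s [ κ ]ᵛ) λ q → trans
            (upd-∉ (λ r → moded-a (before [ κ ]ᵠ) niceκ′ (q , r)))
            (upd-∉ (λ r → apartκ (r , a⊆Gκ (∈-++⁺ˡ q)))))
          ([]-idᵛ (s [ κ ]ᵛ)))
        (sym (trans (cong (_[ κ̂ ]ᵛ) (trans ([]-congᵛ s λ q → ConsumingMGU.fixes mgu₀
            (λ r → moded-a before nice (q , r)) (λ r → apart (∈-++⁺ˡ r , a⊆G (∈-++⁺ˡ q))))
            ([]-idᵛ s)))
          ([]-congᵛ s (κ̂-query ∘ a⊆G ∘ ∈-++⁺ˡ))))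

      unifierκ-t : t [ κ ]ᵛ [ unifierκ ]ᵛ ≡ t [ η₀ ]ᵛ [ κ̂ ]ᵛ
      unifierκ-t = trans ([]-congᵛ (t [ κ ]ᵛ) upd-∈) (proj₂ match)

      unifierκ-h : h [ ρ ]ᵃ [ unifierκ ]ᵃ ≡ h [ η₀ ]ᵃ [ κ̂ ]ᵃ
      unifierκ-h = trans (⨟-termᵃ h) (trans ([]-congᵃ h shifted) (sym (⨟-termᵃ h)))
        where
        shifted : AgreeOn (varsᵃ h) (ρ ⨟ unifierκ) (η₀ ⨟ κ̂)
        shifted {x} q = trans
          (upd-∉ (λ r → apartκ (n+x∈ , a⊆Gκ (∈-++⁺ʳ (varsᵛ (s [ κ ]ᵛ)) r))))
          (trans (upd-∈ n+x∈) (cong (λ y → η₀ y [ κ̂ ]ᵗ) (m+n∸m≡n n x)))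
          where
          n+x∈ : n + x ∈ₗ varsᶜ (d [ ρ ]ᶜ)
          n+x∈ = ∈-[]ˡ⁺ ρ (vars-[]ᵠ (h ∷ B) ρ) (∈-++⁺ˡ q) (here refl)

      unifies-κ : Unifier (a [ κ ]ᵃ) (h [ ρ ]ᵃ) unifierκ
      unifies-κ = trans (cong₂ (atom p) unifierκ-s unifierκ-t)
        (trans (cong (_[ κ̂ ]ᵃ) (ConsumingMGU.unifies mgu₀)) (sym unifierκ-h))

      opaque
        resolved : ∃[ η ] ConsumingMGU (s [ κ ]ᵛ) (t [ κ ]ᵛ) (v [ ρ ]ᵛ) (u [ ρ ]ᵛ) η
        resolved = resolve niceκ′ goodκ apartκ occurs (selectable-[] a sel) unifies-κ

      η : Subst
      η = proj₁ resolved

      mguκ : ConsumingMGU (s [ κ ]ᵛ) (t [ κ ]ᵛ) (v [ ρ ]ᵛ) (u [ ρ ]ᵛ) η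
      mguκ = proj₂ resolved

      open Resolvent {before = before [ κ ]ᵠ} {after = after [ κ ]ᵠ} niceκ′ goodκ apartκ mguκ

      opaque
        -- `κ̂ ⨟ η` unifies the original atom and head, so the generality of `θ` yields the
        -- substitution for the next copy.
        factor : ∃[ κ′ ] (∀ x → (κ̂ ⨟ η) x ≡ θ x [ κ′ ]ᵗ)
        factor = proj₂ mgu (κ̂ ⨟ η)
          (trans (sym (⨟-termᵃ a)) (trans (cong (_[ η ]ᵃ) aκ̂)
            (trans (ConsumingMGU.unifies mguκ)
              (trans (cong (_[ η ]ᵃ) (sym hκ̂)) (⨟-termᵃ h)))))

      κ′ : Subst
      κ′ = proj₁ factor

      opaque
        Rκ̂ : R [ κ̂ ]ᵠ ≡ before [ κ ]ᵠ ++ B [ ρ ]ᵠ ++ after [ κ ]ᵠ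
        Rκ̂ = trans ([]-resolvent before B after κ̂)
          (cong₂ _++_ ([]-congᵠ before (λ q → κ̂-query (before⊆G q)))
            (cong₂ _++_ ([]-congᵠ B (λ q → κ̂-clause (∈-++⁺ʳ (varsᵃ h) q)))
              ([]-congᵠ after (λ q → κ̂-query (after⊆G q)))))

      resultκ : R [ θ ]ᵠ [ κ′ ]ᵠ ≡ resolvent
      resultκ = []-factor R (proj₂ factor) Rκ̂

      step : G [ κ ]ᵠ ⇒ R [ θ ]ᵠ [ κ′ ]ᵠ
      step = record
        { before = before [ κ ]ᵠ ; after = after [ κ ]ᵠ ; s = s [ κ ]ᵛ ; v = v [ ρ ]ᵛ 
        ; t = t [ κ ]ᵛ ; u = u [ ρ ]ᵛ
        ; B = B [ ρ ]ᵠ ; split = splitκ ; clause = c ; clause∈P = c∈P ; variant = variant-shift n variant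
        ; apart = λ (q , r) → apartκ (q , subst (λ Q → _ ∈ₗ varsᵠ Q) splitκ r)
        ; η = η ; mgu = mguκ ; selectable = selectable-[] a sel ; result = resultκ }

      nice′ : Nice (R [ θ ]ᵠ [ κ′ ]ᵠ)
      nice′ = subst Nice (sym resultκ) resolvent-nice

      renamed-fixed : ∀ {k} → k ∈ₗ varsᵠ G → IsVar (κ k) →
                      (∀ {w} → w ∈ₗ vars (κ k) → η w ≡ var w) → IsVar (κ̂ k [ η ]ᵗ)
      renamed-fixed {k} k∈ (w , e) fix =
        w , trans (cong (_[ η ]ᵗ) (trans (κ̂-query k∈) e)) (fix (vars-≡ (var w) (sym e) (here refl)))

      var-before : ∀ {k} → k ∈ₗ outVarsᵠ before → IsVar (κ̂ k [ η ]ᵗ)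
      var-before k∈ = renamed-fixed (before⊆G (outVarsᵠ-⊆ before k∈))
        (κ-renames (subst (_ ∈ₗ_) (sym (outVars-split before a after)) (∈-++⁺ˡ k∈)))
        (λ q → fixes-before (outVarsᵠ-⊆ (before [ κ ]ᵠ) (∈-[]ˡ⁺ κ (outVars-[]ᵠ before κ) k∈ q)))

      var-after : ∀ {k} → k ∈ₗ outVarsᵠ after → IsVar (κ̂ k [ η ]ᵗ)
      var-after k∈ = renamed-fixed (after⊆G (outVarsᵠ-⊆ after k∈))
        (κ-renames (subst (_ ∈ₗ_) (sym (outVars-split before a after))
          (∈-++⁺ʳ (outVarsᵠ before) (∈-++⁺ʳ (varsᵛ t) k∈))))
        (λ q → fixes-after (∈-[]ˡ⁺ κ (outVars-[]ᵠ after κ) k∈ q))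

      shift-var : ∀ r {k} → r [ ρ ]ᵗ ≡ var (n + k) → r ≡ var k
      shift-var (var x) e = cong var (+-cancelˡ-≡ n _ _ (var-injective e))

      -- A link would join `k` to a non-variable output of the copied atom. But `θ` unifies the
      -- original output with `k`, whose value is a variable, so that output is a variable and `κ`
      -- only renames it.
      var-body : ∀ {k} → k ∈ₗ outVarsᵠ B → IsVar (θ k) → IsVar (κ̂ k [ η ]ᵗ)
      var-body {k} k∈ (y , θk) with body-link (∈-[]ˡ⁺ ρ (outVars-[]ᵠ B ρ) k∈ (here refl))
      ... | inj₁ e = n + k , trans (cong (_[ η ]ᵗ) (κ̂-clause (∈-++⁺ʳ (varsᵃ h) (outVarsᵠ-⊆ B k∈)))) e
      ... | inj₂ (j , uj , _ , nonvar) =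
        contradiction (t-var (proj₂ (IsVar-[]⁻ (lookup t j) (y , tjθ)))) nonvar
        where
        ujk : lookup u j ≡ var k
        ujk = shift-var (lookup u j) (trans (sym (lookup-[] u ρ j)) uj)
        tjθ : lookup t j [ θ ]ᵗ ≡ var y
        tjθ = trans (sym (lookup-[] t θ j))
          (trans (cong (λ b → lookup b j) (proj₂ (atom-injective (proj₁ mgu))))
          (trans (lookup-[] u θ j) (trans (cong (_[ θ ]ᵗ) ujk) θk)))

      var-R : ∀ {k} → k ∈ₗ outVarsᵠ R → IsVar (θ k) → IsVar (κ̂ k [ η ]ᵗ)
      var-R k∈ v with ∈-++⁻ (outVarsᵠ before) (subst (_ ∈ₗ_) (concatMap-++ outVars before (B ++ after)) k∈)
      ... | inj₁ q = var-before q
      ... | inj₂ q with ∈-++⁻ (outVarsᵠ B) (subst (_ ∈ₗ_) (concatMap-++ outVars B after) q)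
      ... | inj₁ r = var-body r v
      ... | inj₂ r = var-after r

      -- In a non-variable output term of the new query, flatness of its image in the nice copy
      -- forces `κ′` to rename. For a variable output flatness says nothing, and the factorisation
      -- through `κ̂ ⨟ η` decides.
      κ′-renames : VarOn (outVarsᵠ (R [ θ ]ᵠ)) κ′
      κ′-renames {y} q with ∈-concatMap-∃ {f = outVars} {xs = R [ θ ]ᵠ} q
      ... | b′ , b′∈ , q′ with ∈-map⁻ (_[ θ ]ᵃ) b′∈
      ... | b , b∈ , refl with ∈-lookup (outs b [ θ ]ᵛ) q′
      ... | i , q″ =
        go (lookup (outs b) i) refl (vars-≡ (lookup (outs b [ θ ]ᵛ) i) (lookup-[] (outs b) θ i) q″)
        where
        flat : Flat (lookup (outs b) i [ θ ]ᵗ [ κ′ ]ᵗ)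
        flat = subst Flat
          (trans (lookup-[] (outs b [ θ ]ᵛ) κ′ i) (cong (_[ κ′ ]ᵗ) (lookup-[] (outs b) θ i)))
          (RobustOuts-flat (b [ θ ]ᵃ [ κ′ ]ᵃ)
            (All.lookup (Nice.robust nice′) (∈-map⁺ (_[ κ′ ]ᵃ) (∈-map⁺ (_[ θ ]ᵃ) b∈))) i)

        go : ∀ r → lookup (outs b) i ≡ r → y ∈ₗ vars (lookup (outs b) i [ θ ]ᵗ) → IsVar (κ′ y)
        go r e y∈ with IsVar? (lookup (outs b) i [ θ ]ᵗ)
        ... | no  nonvar = Flat-[]-VarOn (lookup (outs b) i [ θ ]ᵗ) nonvar flat y∈
        go (app _ _) e y∈ | yes (z , ez) = case trans (sym (cong (_[ θ ]ᵗ) e)) ez of λ ()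
        go (var k)   e y∈ | yes (z , ez) with vars-≡ (lookup (outs b) i [ θ ]ᵗ) ez y∈
        ... | here refl = subst IsVar
              (trans (proj₂ factor k) (cong (_[ κ′ ]ᵗ) θk))
              (var-R (outVars-⊆ {R} b∈ (lookup-varᵛ (outs b) i e)) (z , θk))
          where
          θk : θ k ≡ var z
          θk = trans (sym (cong (_[ θ ]ᵗ) e)) ez

      fresh′ : ∀ {w} → w ∈ₗ outVarsᵠ (R [ θ ]ᵠ [ κ′ ]ᵠ) → w ∈ₗ outVarsᵠ (G [ κ ]ᵠ) ⊎ N ≤ w
      fresh′ {w} q with resolvent-outs-∈ (subst (λ Q → w ∈ₗ outVarsᵠ Q) resultκ q)
      ... | inj₁ r = inj₁ (subst (λ Q → w ∈ₗ outVarsᵠ Q) (sym splitκ) r)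
      ... | inj₂ r = inj₂ (≤-trans N≤n (n≤ (∈-++⁺ʳ (varsᵃ (h [ ρ ]ᵃ)) r)))

      agrees′ : ∀ {x} → x ∉ₗ varsᶜ d → (∀ {w} → w ∈ₗ vars (κ x) → w ∉ₗ outVarsᵠ (G [ κ ]ᵠ) × w < N) →
                θ x [ κ′ ]ᵗ ≡ κ x
      agrees′ {x} x∉ avoid = trans (sym (proj₂ factor x)) (trans (cong (_[ η ]ᵗ) (upd-∉ x∉))
        (trans ([]-congᵗ (κ x) λ {w} q → let (w∉ , w<N) = avoid q in ConsumingMGU.fixes mguκ
            (λ r → w∉ (subst (λ Q → w ∈ₗ outVarsᵠ Q) (sym splitκ)
                (subst (w ∈ₗ_) (sym (outVars-split (before [ κ ]ᵠ) (a [ κ ]ᵃ) (after [ κ ]ᵠ)))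
                  (∈-++⁺ʳ (outVarsᵠ (before [ κ ]ᵠ)) (∈-++⁺ˡ r)))))
            (λ r → <⇒≱ (<-≤-trans w<N N≤n) (n≤ (∈-++⁺ˡ r))))
          ([]-idᵗ (κ x))))

    simulate-split : ∃[ κ′ ] ((G [ κ ]ᵠ ⇒ R [ θ ]ᵠ [ κ′ ]ᵠ) × VarOn (outVarsᵠ (R [ θ ]ᵠ)) κ′ ×
      (∀ {w} → w ∈ₗ outVarsᵠ (R [ θ ]ᵠ [ κ′ ]ᵠ) → w ∈ₗ outVarsᵠ (G [ κ ]ᵠ) ⊎ N ≤ w) ×
      (∀ {x} → x ∉ₗ varsᶜ d → (∀ {w} → w ∈ₗ vars (κ x) → w ∉ₗ outVarsᵠ (G [ κ ]ᵠ) × w < N) →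
        θ x [ κ′ ]ᵗ ≡ κ x))
    simulate-split = κ′ , step , κ′-renames , fresh′ , agrees′

  simulate : ∀ {G G′ κ} (step : Step P G G′) → Selectable P (selected step) →
             VarOn (outVarsᵠ G) κ → Nice (G [ κ ]ᵠ) → ∀ N → Simulates step κ N
  simulate record { before = before ; selected = atom p s t ; after = after ; split = refl ; clause∈P = c∈P
                  ; renamed = atom q v u ⟵ B ; variant = variant ; apart = apart ; mgu = mgu ; result = refl }
           sel renames nice N with cong pred (proj₁ mgu)
  ... | refl with simulate-split {before = before} N sel renames nice c∈P variant apart mgu
  ... | κ′ , step , r , f , g = record { κ′ = κ′ ; simulated = step ; renames = r ; fresh = f ; agrees = g }

-- Termination of concatenated queries.

module Termination (em : ExcludedMiddle 0ℓ) (S : Signature) (τ : Syntax.Typing S) (P : Syntax.Program S)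
  (robust-program : Typed.RobustlyTypedProgram S τ P)
  (input-linear   : Syntax.InputLinear S P)
  (selectability  : Typed.InputSelectability S τ P)
  where
  open Syntax S
  open Typing τ
  open Typed S τ
  open Substitutions S
  open Resolution em S
  open RobustTyping em S τ
  open RobustQueries P
  open Steps em S τ P robust-program input-linear selectability
  open Simulation em S τ P robust-program input-linear selectability

  Terminating : Query → Set
  Terminating = Acc (λ Q′ Q → Q ⇒ Q′)

  renamedᶜ : ∀ {Q Q′} → Q ⇒ Q′ → Clause
  renamedᶜ step = atom p v u ⟵ B where open _⇒_ step

  -- Each bound output term has a correctly typed instance by type-consistency, each free one
  -- because it is a variable and types are non-empty. Linearity glues these instances.
  typable : ∀ {Q} → Nice Q → ∃[ ω ] All OutTyped (Q [ ω ]ᵠ)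
  typable {[]}    _ = var , []
  typable {a ∷ Q} n with Unique-++⁻ (outVars a) (Nice.linear n) | typable (proj₂ (Nice-++⁻ (a ∷ []) n))
  ... | u , _ , d | ω , typed-Q =
    upd (outVars a) (proj₁ typed-a) ω ,
    OutTyped-cong a (λ q → sym (upd-∈ q)) (OutTyped-lookup a (proj₂ typed-a)) ∷
    All.map⁺ (All.tabulate λ {b} b∈ →
      OutTyped-cong b (λ q → sym (upd-∉ (λ r → d (r , outVars-⊆ {Q} b∈ q))))
        (All.lookup (All.map⁻ typed-Q) b∈))
    where
    instances : ∀ i → TypeConsistent (outType (pred a) i) (lookup (outs a) i)
    instances i with em {P = BoundOut P (pred a) i}
    ... | yes b = proj₂ (proj₂ (All.head (Nice.robust n)) i b)
    ... | no  f with proj₁ (All.head (Nice.robust n)) i f | Type.nonEmpty (outType (pred a) i)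
    ... | x , e | r , r∈ = (λ _ → r) , subst (λ w → w [ (λ _ → r) ]ᵗ ∈ ⟦ outType (pred a) i ⟧) (sym e) r∈

    typed-a : ∃[ σ ] (∀ i → lookup (outs a) i [ σ ]ᵗ ∈ ⟦ outType (pred a) i ⟧)
    typed-a with gather (outs a) u (proj₁ ∘ instances)
    ... | σ , e = σ , λ i → subst (_∈ ⟦ outType (pred a) i ⟧) (sym (e i)) (proj₂ (instances i))

  prefix-avoids : ∀ F {G} → Nice (F ++ G) → Disjoint (varsᵠ F) (outVarsᵠ G)
  prefix-avoids F {G} n (q , r) with varsᵠ-cases F q
  ... | inj₁ q′ = proj₂ (proj₂ (Moded-++⁻ F (Nice.moded n))) (q′ , r)
  ... | inj₂ q′ = proj₂ (proj₂ (Unique-++⁻ (outVarsᵠ F)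
                    (subst Unique (concatMap-++ outVars F G) (Nice.linear n)))) (q′ , r)

  module _ {Q Q′} (step : Q ⇒ Q′) where
    open _⇒_ step

    step-scope : ∀ {x} → x ∈ₗ varsᵠ Q ⊎ x ∈ₗ varsᶜ (renamedᶜ step) →
                 ∀ {y} → y ∈ₗ vars (η x) → y ∈ₗ varsᵠ Q ⊎ y ∈ₗ varsᶜ (renamedᶜ step)
    step-scope {x} x∈ q with ConsumingMGU.scope mgu x q
    ... | here refl = x∈
    ... | there r with ∈-++⁻ (varsᵃ (atom p s t)) r
    ... | inj₁ r′ = inj₁ (subst (λ Q → _ ∈ₗ varsᵠ Q) (sym split) (varsᵠ-++⁺ʳ before (∈-++⁺ˡ r′)))
    ... | inj₂ r′ = inj₂ (∈-++⁺ˡ r′)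

    step-vars : ∀ {y} → y ∈ₗ varsᵠ Q′ → y ∈ₗ varsᵠ Q ⊎ y ∈ₗ varsᶜ (renamedᶜ step)
    step-vars {y} q with ∈-[]ˡ⁻ η (vars-[]ᵠ (before ++ B ++ after) η) (subst (λ Q → y ∈ₗ varsᵠ Q) result q)
    ... | x , x∈ , r = step-scope old r
      where
      old : x ∈ₗ varsᵠ Q ⊎ x ∈ₗ varsᶜ (renamedᶜ step)
      old with varsᵠ-++⁻ before x∈
      ... | inj₁ w = inj₁ (subst (λ Q → x ∈ₗ varsᵠ Q) (sym split) (varsᵠ-++⁺ˡ before w))
      ... | inj₂ w with varsᵠ-++⁻ B w
      ... | inj₁ w′ = inj₂ (∈-++⁺ʳ (varsᵃ (atom p v u)) w′)
      ... | inj₂ w′ = inj₁ (subst (λ Q → x ∈ₗ varsᵠ Q) (sym split)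
                        (varsᵠ-++⁺ʳ before (∈-++⁺ʳ (varsᵃ (atom p s t)) w′)))

    step-fixes : ∀ {x} → x ∉ₗ outVarsᵠ Q → x ∉ₗ varsᶜ (renamedᶜ step) → η x ≡ var x
    step-fixes {x} x∉Q x∉c = ConsumingMGU.fixes mgu
      (λ q → x∉Q (subst (λ Q → x ∈ₗ outVarsᵠ Q) (sym split)
        (subst (x ∈ₗ_) (sym (outVars-split before (atom p s t) after)) (∈-++⁺ʳ (outVarsᵠ before) (∈-++⁺ˡ q)))))
      (λ q → x∉c (∈-++⁺ˡ q))

  -- Correct outputs travel backwards: the atoms to the left ensure typed inputs for the selected
  -- atom, and then the clause turns correct body outputs into correct head outputs.
  step-outTyped : ∀ {Q Q′} → RT Q → (step : Q ⇒ Q′) → ∀ ω → All OutTyped (Q′ [ ω ]ᵠ) →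
                  All OutTyped (Q [ _⇒_.η step ⨟ ω ]ᵠ)
  step-outTyped rt record { before = before ; after = after ; B = B ; split = refl ; clause∈P = c∈P
                          ; variant = var′ ; η = η ; mgu = mgu ; result = refl } ω typed
    with All.++⁻ (before [ η ⨟ ω ]ᵠ) (subst (All OutTyped)
           (trans (⨟-termᵠ (before ++ B ++ after)) ([]-resolvent before B after (η ⨟ ω))) typed)
  ... | typed₁ , typed-rest with All.++⁻ (B [ η ⨟ ω ]ᵠ) typed-rest
  ... | typed-B , typed₂ = subst (All OutTyped) (sym ([]-++ before _ (η ⨟ ω)))
    (All.++⁺ typed₁ (ClauseChain.head-typed
      (step-typed ω (variant-good c∈P var′) (ConsumingMGU.unifies mgu)
        (Chain⁻ (before [ η ⨟ ω ]ᵠ) (subst Chain ([]-++ before _ (η ⨟ ω)) (RT.chain rt (η ⨟ ω))) typed₁)) typed-B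
      ∷ typed₂))

  -- What the computation of F may still do to G: an instance of G by ω, except that
  -- the output variables of G are renamed away from ω.
  record Instance (F G : Query) (ω : Subst) : Set where
    field
      κ           : Subst
      agrees      : ∀ {x} → x ∈ₗ varsᵠ F → x ∈ₗ varsᵠ G → κ x ≡ ω x
      avoids      : ∀ {x w} → x ∈ₗ varsᵠ F → x ∈ₗ varsᵠ G → w ∈ₗ vars (ω x) → w ∉ₗ outVarsᵠ (G [ κ ]ᵠ)
      renames     : VarOn (outVarsᵠ G) κ
      nice        : Nice (G [ κ ]ᵠ)
      terminating : Terminating (G [ κ ]ᵠ)

  -- All typing substitutions are covered because a step of `F` may rule out the one considered so
  -- far.
  Continuable : Query → Query → Set
  Continuable F G = ∀ ω → All OutTyped (F [ ω ]ᵠ) → Instance F G ω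

  -- The promise for `ω` after the step is the old promise for `η ⨟ ω`. Letting `κ′` follow `ω` on
  -- the variables of `F` and of the clause makes `η ⨟ κ′` agree with `κ` on `G`, so the copy is
  -- literally the same query.
  continue-left : ∀ {F F′ G} → RT F → Disjoint (varsᵠ F) (outVarsᵠ G) → (step : F ⇒ F′) →
                  Disjoint (varsᶜ (renamedᶜ step)) (varsᵠ G) →
                  Continuable F G → Continuable F′ (G [ _⇒_.η step ]ᵠ)
  continue-left {F} {F′} {G} rt disj step apart k ω typed = record
    { κ           = κ′
    ; agrees      = λ x∈F′ _ → upd-∈ (in-V (step-vars step x∈F′))
    ; avoids      = avoids′
    ; renames     = renames′
    ; nice        = subst Nice (sym Gκ′) nice
    ; terminating = subst Terminating (sym Gκ′) terminating
    }
    where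
    open _⇒_ step using (η)
    open Instance (k (η ⨟ ω) (step-outTyped rt step ω typed))

    V : List Var
    V = varsᵠ F ++ varsᶜ (renamedᶜ step)

    in-V : ∀ {x} → x ∈ₗ varsᵠ F ⊎ x ∈ₗ varsᶜ (renamedᶜ step) → x ∈ₗ V
    in-V (inj₁ q) = ∈-++⁺ˡ q
    in-V (inj₂ q) = ∈-++⁺ʳ (varsᵠ F) q

    ∉V : ∀ {x} → x ∈ₗ varsᵠ G → x ∉ₗ varsᵠ F → x ∉ₗ V
    ∉V x∈G x∉F q with ∈-++⁻ (varsᵠ F) q
    ... | inj₁ r = x∉F r
    ... | inj₂ r = apart (r , x∈G)

    κ′ : Subst
    κ′ = upd V ω κ

    fixed : ∀ {z} → z ∈ₗ varsᵠ G → z ∉ₗ varsᵠ F → η z ≡ var z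
    fixed z∈G z∉F = step-fixes step (z∉F ∘ outVarsᵠ-⊆ F) (λ r → apart (r , z∈G))

    κ′-η : AgreeOn (varsᵠ G) (η ⨟ κ′) κ
    κ′-η {z} z∈G with z ∈? varsᵠ F
    ... | yes z∈F = trans ([]-congᵗ (η z) (λ q → upd-∈ (in-V (step-scope step (inj₁ z∈F) q))))
                          (sym (agrees z∈F z∈G))
    ... | no  z∉F = trans (cong (_[ κ′ ]ᵗ) (fixed z∈G z∉F)) (upd-∉ (∉V z∈G z∉F))

    Gκ′ : G [ η ]ᵠ [ κ′ ]ᵠ ≡ G [ κ ]ᵠ
    Gκ′ = trans (⨟-termᵠ G) ([]-congᵠ G κ′-η)

    avoids′ : ∀ {x w} → x ∈ₗ varsᵠ F′ → x ∈ₗ varsᵠ (G [ η ]ᵠ) → w ∈ₗ vars (ω x) →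
              w ∉ₗ outVarsᵠ (G [ η ]ᵠ [ κ′ ]ᵠ)
    avoids′ {x} {w} x∈F′ x∈Gη w∈ out with ∈-[]ˡ⁻ η (vars-[]ᵠ G η) x∈Gη
    ... | z , z∈G , x∈ with z ∈? varsᵠ F
    ... | yes z∈F = avoids z∈F z∈G (∈-[]ˡ⁺ ω (vars-[]ᵗ (η z) ω) x∈ w∈) (subst (λ Q → w ∈ₗ outVarsᵠ Q) Gκ′ out)
    ... | no  z∉F with vars-≡ (η z) (fixed z∈G z∉F) x∈
    ... | here refl = ∉V z∈G z∉F (in-V (step-vars step x∈F′))

    renames′ : VarOn (outVarsᵠ (G [ η ]ᵠ)) κ′
    renames′ q with ∈-[]ˡ⁻ η (outVars-[]ᵠ G η) q
    ... | z , z∈ , r with fixed (outVarsᵠ-⊆ G z∈) (λ z∈F → disj (z∈F , z∈))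
    ... | e with vars-≡ (η z) e r
    ... | here refl = subst IsVar (sym (upd-∉ (∉V (outVarsᵠ-⊆ G z∈) (λ z∈F → disj (z∈F , z∈))))) (renames z∈)

  -- Every promised copy takes the simulating step. The bound `N` lies above the variables of `F`
  -- under `ω`, which keeps new outputs of the copy away from them.
  continue-right : ∀ {F G G′} → (step : G ⇒ G′) → Disjoint (varsᶜ (renamedᶜ step)) (varsᵠ F) →
                   (∀ {x} → x ∈ₗ varsᵠ F → _⇒_.η step x ≡ var x) →
                   Continuable F G → Continuable F G′
  continue-right {F} {G} {G′} step apart fixed k ω typed = record
    { κ           = κ′
    ; agrees      = λ {x} x∈F x∈G′ →
        trans (trans (sym (cong (_[ κ′ ]ᵗ) (fixed x∈F)))
          (sim-agrees (λ r → apart (r , x∈F))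
            λ {w} q → let q′ = vars-≡ (κ x) (agrees x∈F (old x∈F x∈G′)) q in
              avoids x∈F (old x∈F x∈G′) q′ , below x∈F q′))
          (agrees x∈F (old x∈F x∈G′))
    ; avoids      = λ x∈F x∈G′ w∈ out → case fresh out of λ
        { (inj₁ q) → avoids x∈F (old x∈F x∈G′) w∈ q
        ; (inj₂ q) → <⇒≱ (below x∈F w∈) q }
    ; renames     = sim-renames
    ; nice        = ⇒-nice nice simulated
    ; terminating = Acc-inverse terminating simulated
    }
    where
    open Instance (k ω typed)

    N : ℕ
    N = freshness-bound (varsᵠ (F [ ω ]ᵠ))

    open Simulates (simulate (toStep step) (toStep-selectable step) renames nice N)
      renaming (renames to sim-renames; agrees to sim-agrees)

    Acc-inverse : ∀ {Q Q′} → Terminating Q → Q ⇒ Q′ → Terminating Q′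
    Acc-inverse (acc rs) = rs

    below : ∀ {x w} → x ∈ₗ varsᵠ F → w ∈ₗ vars (ω x) → w < N
    below x∈F q = <-freshness-bound (∈-[]ˡ⁺ ω (vars-[]ᵠ F ω) x∈F q)

    old : ∀ {x} → x ∈ₗ varsᵠ F → x ∈ₗ varsᵠ G′ → x ∈ₗ varsᵠ G
    old x∈F x∈G′ with step-vars step x∈G′
    ... | inj₁ q = q
    ... | inj₂ q = contradiction (q , x∈F) apart

  LeftStep RightStep : Query → Query → Query → Set
  LeftStep F G Q′ = ∃[ F′ ] Σ[ step ∈ F ⇒ F′ ]
    (Disjoint (varsᶜ (renamedᶜ step)) (varsᵠ G) × Q′ ≡ F′ ++ G [ _⇒_.η step ]ᵠ)
  RightStep F G Q′ = ∃[ G′ ] Σ[ step ∈ G ⇒ G′ ]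
    (Disjoint (varsᶜ (renamedᶜ step)) (varsᵠ F) ×
     (∀ {x} → x ∈ₗ varsᵠ F → _⇒_.η step x ≡ var x) × Q′ ≡ F ++ G′)

  split-step : ∀ F {G Q′} → Nice (F ++ G) → F ++ G ⇒ Q′ → LeftStep F G Q′ ⊎ RightStep F G Q′
  split-step F {G} nice step with split-++ F {us = _⇒_.before step} (_⇒_.split step)
  ... | inj₁ (ws , refl , refl) = inj₁ (_ ,
    record { before = before ; after = ws ; s = s ; v = v ; t = t ; u = u ; B = B ; split = refl
           ; clause = clause ; clause∈P = clause∈P ; variant = variant
           ; apart = λ (q , r) → apart (q , varsᵠ-++⁺ˡ F r)
           ; η = η ; mgu = mgu ; selectable = selectable ; result = refl } ,
    (λ (q , r) → apart (q , varsᵠ-++⁺ʳ F r)) ,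
    trans result (trans (cong (_[ η ]ᵠ)
      (trans (cong (before ++_) (sym (++-assoc B ws G))) (sym (++-assoc before (B ++ ws) G))))
      ([]-++ (before ++ B ++ ws) G η)))
    where open _⇒_ step
  ... | inj₂ (ws , refl , refl) = inj₂ (_ ,
    stepG ,
    (λ (q , r) → apart (q , varsᵠ-++⁺ˡ F r)) , fixed ,
    trans result (trans (cong (_[ η ]ᵠ) (++-assoc F ws (B ++ after)))
      (trans ([]-++ F (ws ++ B ++ after) η)
        (cong (_++ (ws ++ B ++ after) [ η ]ᵠ) (trans ([]-congᵠ F fixed) ([]-idᵠ F))))))
    where
    open _⇒_ step hiding (before)
    stepG : G ⇒ (ws ++ B ++ after) [ η ]ᵠ
    stepG = record
      { before = ws ; after = after ; s = s ; v = v ; t = t ; u = u ; B = B ; split = refl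
      ; clause = clause ; clause∈P = clause∈P ; variant = variant
      ; apart = λ (q , r) → apart (q , varsᵠ-++⁺ʳ F r)
      ; η = η ; mgu = mgu ; selectable = selectable ; result = refl }
    fixed : AgreeOn (varsᵠ F) η var
    fixed x∈F = step-fixes stepG (λ r → prefix-avoids F nice (x∈F , r)) (λ r → apart (r , varsᵠ-++⁺ˡ F x∈F))

  -- The inner induction, on one copy of `G`. A step of `F` drops this copy and hands over to `rec`,
  -- which draws another from the updated promises.
  combine-instance : ∀ {F G κ} →
    (∀ {F′ G} → F ⇒ F′ → RT (F′ ++ G) → Continuable F′ G → Terminating (F′ ++ G)) →
    Terminating (G [ κ ]ᵠ) → VarOn (outVarsᵠ G) κ → Nice (G [ κ ]ᵠ) →
    RT (F ++ G) → Continuable F G → Terminating (F ++ G)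
  combine-instance {F} {G} {κ} rec (acc rs) renames nice rt k =
    acc λ step → after-step step (split-step F (RT.nice rt) step)
    where
    after-step : ∀ {Q′} → F ++ G ⇒ Q′ → LeftStep F G Q′ ⊎ RightStep F G Q′ → Terminating Q′
    after-step step (inj₁ (F′ , step-F , apart , refl)) =
      rec step-F (⇒-RT rt step)
        (continue-left (RT-++ˡ F rt) (prefix-avoids F (RT.nice rt)) step-F apart k)
    after-step step (inj₂ (G′ , step-G , apart , fixed , refl)) =
      combine-instance {κ = κ′} rec (rs simulated) sim-renames (⇒-nice nice simulated) (⇒-RT rt step)
        (continue-right step-G apart fixed k)
      where
      -- The bound `0` imposes no freshness: this copy only measures how long `G` can run and is
      -- never compared with `F`.
      open Simulates (simulate (toStep step-G) (toStep-selectable step-G) renames nice 0)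
        renaming (renames to sim-renames)

  combine : ∀ {F G} → Terminating F → RT (F ++ G) → Continuable F G → Terminating (F ++ G)
  combine {F} {G} (acc rs) rt k =
    combine-instance {κ = κ} (λ step → combine (rs step)) terminating renames nice rt k
    where
    typed : ∃[ ω ] All OutTyped (F [ ω ]ᵠ)
    typed = typable (RT.nice (RT-++ˡ F rt))
    open Instance (k (proj₁ typed) (proj₂ typed))

-- From well-recurrence to robustness.

module Levels (em : ExcludedMiddle 0ℓ) (S : Signature) (τ : Syntax.Typing S) (P : Syntax.Program S)
  (robust-program : Typed.RobustlyTypedProgram S τ P)
  (input-linear   : Syntax.InputLinear S P)
  (selectability  : Typed.InputSelectability S τ P)
  where
  open Syntax S
  open Typing τ
  open Typed S τ
  open Substitutions S
  open Resolution em S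
  open RobustTyping em S τ
  open RobustQueries P
  open Steps em S τ P robust-program input-linear selectability
  open Simulation em S τ P robust-program input-linear selectability
  open Termination em S τ P robust-program input-linear selectability

  NonTerminating : Set
  NonTerminating = Σ[ Q ∈ Query ] ¬ Terminating Q

  -- Deciding the existential also returns a witness, so iterating gives an actual infinite
  -- derivation.
  next : (q : NonTerminating) → Σ[ q′ ∈ NonTerminating ] proj₁ q ⇒ proj₁ q′
  next (Q , n) with em {P = ∃[ Q′ ] (Q ⇒ Q′ × ¬ Terminating Q′)}
  ... | yes (Q′ , step , n′) = (Q′ , n′) , step
  ... | no  none = contradiction (acc λ {Q′} step → em⇒dne em λ n′ → none (Q′ , step , n′)) n

  run : NonTerminating → ℕ → NonTerminating
  run q zero    = q
  run q (suc n) = proj₁ (next (run q n))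

  robust-terminating : ∀ {p s t} → Robust P p → RT [ atom p s t ] → Terminating [ atom p s t ]
  robust-terminating {p} {s} {t} rob rt = em⇒dne em λ n →
    let q = ([ atom p s t ] , n) in
    rob s t (RT⁻ rt) (infinite (proj₁ ∘ run q) refl (λ k → toStep (proj₂ (next (run q k)))))
      (λ k → toStep-selectable (proj₂ (next (run q k))))

  -- The derivation may use any mgus, whereas accessibility concerns canonical steps. A copy that
  -- differs by a renaming of outputs follows it along `⇒`.
  terminating-finite : ∀ {R} → Terminating R → ∀ (Qs : ℕ → Query) {κ} → Qs 0 [ κ ]ᵠ ≡ R →
                       VarOn (outVarsᵠ (Qs 0)) κ → Nice (Qs 0 [ κ ]ᵠ) →
                       (steps : ∀ n → Step P (Qs n) (Qs (suc n))) → ¬ (∀ n → Selectable P (selected (steps n)))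
  terminating-finite (acc rs) Qs refl renames nice steps sel =
    terminating-finite (rs simulated) (Qs ∘ suc) {κ′} refl sim-renames (⇒-nice nice simulated)
      (steps ∘ suc) (sel ∘ suc)
    where
    open Simulates (simulate (steps 0) (sel 0) renames nice 0) renaming (renames to sim-renames)

  terminating-robust : ∀ {p} → (∀ s t → RT [ atom p s t ] → Terminating [ atom p s t ]) → Robust P p
  terminating-robust h s t rt (finite _)              _   = tt
  terminating-robust h s t rt (infinite Qs Qs₀ steps) sel =
    terminating-finite (h s t (RT⁺ rt)) Qs {var} id₀ (λ _ → _ , refl)
      (subst Nice (sym id₀) (RT.nice (RT⁺ rt))) steps sel
    where
    id₀ : Qs 0 [ var ]ᵠ ≡ _
    id₀ = trans ([]-idᵠ (Qs 0)) Qs₀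

  Unique-shift : ∀ {n xs ys} → ys ≡ xs [ shift n ]ˡ → Unique xs → Unique ys
  Unique-shift {n} refl u = Unique-concatMap⁺ u (λ _ → [] ∷ [])
    λ { _ _ x≢y (here refl , here e) → x≢y (+-cancelˡ-≡ n _ _ e) }

  Flat-shift : ∀ {n t} → Flat t → Flat (t [ shift n ]ᵗ)
  Flat-shift {n} (flat-var x)      = flat-var (n + x)
  Flat-shift {n} (flat-app f xs u) = args-flat
    (Unique-shift {n} (vars-[]ᵛ (Vec.map var xs) (shift n)) (subst Unique (sym (varsᵛ-map-var xs)) u))
    λ i → n + lookup xs i , trans (lookup-[] (Vec.map var xs) (shift n) i)
                               (cong (_[ shift n ]ᵗ) (lookup-map-var xs i))

  shift-unshift : ∀ n t → t [ shift n ]ᵗ [ unshift n ]ᵗ ≡ t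
  shift-unshift n t = trans (⨟-termᵗ t)
    (trans ([]-congᵗ t (λ {x} _ → cong var (m+n∸m≡n n x))) ([]-idᵗ t))

  RobustOuts-shift : ∀ n a {s} → RobustOuts P a → RobustOuts P (atom (pred a) s (outs a [ shift n ]ᵛ))
  RobustOuts-shift n a (free , bound) =
    (λ i f → subst IsVar (sym (lookup-[] (outs a) (shift n) i)) (var-shift (free i f))) ,
    (λ i b → subst (λ r → Flat r × TypeConsistent (outType (pred a) i) r) (sym (lookup-[] (outs a) (shift n) i))
      (let (fl , σ , tc) = bound i b in
        Flat-shift fl , unshift n ⨟ σ ,
        subst (_∈ ⟦ outType (pred a) i ⟧)
          (trans (cong (_[ σ ]ᵗ) (sym (shift-unshift n (lookup (outs a) i))))
                 (⨟-termᵗ (lookup (outs a) i [ shift n ]ᵗ))) tc))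
    where
    var-shift : ∀ {r} → IsVar r → IsVar (r [ shift n ]ᵗ)
    var-shift (x , refl) = n + x , refl

  InTyped-[] : ∀ {a} σ → InTyped a → InTyped (a [ σ ]ᵃ)
  InTyped-[] {a} σ i k = subst (_∈ ⟦ inType (pred a) k ⟧) (sym (lookup-[] (ins a) σ k))
    (Type.closed (inType (pred a) k) σ (i k))

  module _ {F b G} (rt : RT (F ++ b ∷ G)) {ω} (typed : All OutTyped (F [ ω ]ᵠ)) where

    private
      n : ℕ
      n = freshness-bound (varsᵠ (F ++ b ∷ []) [ ω ]ˡ)

    -- `ω` is to act on the inputs of `b` only. Its effect on the output variables of `b` is
    -- arbitrary and could spoil linearity or flatness, so these are shifted beyond every variable
    -- in the images of `F` and `b`.
    freshened : Subst
    freshened = upd (outVars b) (shift n) ω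

    private
      κ : Subst
      κ = freshened

      rt-b : RT (F ++ b ∷ [])
      rt-b = RT-++ˡ (F ++ b ∷ []) (subst RT (sym (++-assoc F (b ∷ []) G)) rt)

      b-nice : Nice (b ∷ [])
      b-nice = proj₂ (Nice-++⁻ F (RT.nice rt-b))

      below : ∀ {x w} → x ∈ₗ varsᵠ (F ++ b ∷ []) → w ∈ₗ vars (ω x) → w < n
      below x∈ w∈ = <-freshness-bound (∈-[]ˡ⁺ ω refl x∈ w∈)

      ins∉ : ∀ {x} → x ∈ₗ inVars b → x ∉ₗ outVars b
      ins∉ q r = proj₁ (Nice.moded b-nice) (q , ∈-++⁺ˡ r)

      outs-shift : outs b [ κ ]ᵛ ≡ outs b [ shift n ]ᵛ
      outs-shift = []-congᵛ (outs b) upd-∈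

      outs-above : ∀ {w} → w ∈ₗ outVars (b [ κ ]ᵃ) → n ≤ w
      outs-above q = shift-≤ n (outVars b) (trans (cong varsᵛ outs-shift) (vars-[]ᵛ (outs b) (shift n))) q

      outs-[] : ∀ {w} → w ∈ₗ outVarsᵠ ((b ∷ []) [ κ ]ᵠ) → w ∈ₗ outVars (b [ κ ]ᵃ)
      outs-[] = subst (_ ∈ₗ_) (++-identityʳ _)

    ins-instance : ins b [ κ ]ᵛ ≡ ins b [ ω ]ᵛ
    ins-instance = []-congᵛ (ins b) (upd-∉ ∘ ins∉)

    instance-typed : InTyped (b [ ω ]ᵃ)
    instance-typed = Chain⁻ (F [ ω ]ᵠ) (subst Chain ([]-++ F (b ∷ G) ω) (RT.chain rt ω)) typed

    -- Typed outputs of `F` give typed inputs of `b`, and types are closed under instantiation. So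
    -- the copy is robustly typed on its own, detached from `F`.
    instance-RT : RT ((b ∷ []) [ κ ]ᵠ)
    instance-RT = record
      { nice  = record
        { linear = subst Unique (sym (++-identityʳ _))
            (Unique-shift {n} (trans (cong varsᵛ outs-shift) (vars-[]ᵛ (outs b) (shift n)))
              (proj₁ (Unique-++⁻ (outVars b) (Nice.linear b-nice))))
        ; moded  = (λ (q , r) → <⇒≱ (ins-below q) (outs-above (outs-[] r))) , tt
        ; robust = subst (λ ts → RobustOuts P (atom (pred b) (ins b [ κ ]ᵛ) ts)) (sym outs-shift)
                     (RobustOuts-shift n b {ins b [ κ ]ᵛ} (All.head (Nice.robust b-nice))) ∷ []
        }
      ; chain = λ σ → InTyped-[] {b [ κ ]ᵃ} σ κ-typed , λ _ → tt
      }
      where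
      κ-typed : InTyped (b [ κ ]ᵃ)
      κ-typed i = subst (λ ts → lookup ts i ∈ ⟦ inType (pred b) i ⟧) (sym ins-instance) (instance-typed i)
      ins-below : ∀ {w} → w ∈ₗ varsᵛ (ins b [ κ ]ᵛ) → w < n
      ins-below q with ∈-[]ˡ⁻ ω {inVars b} (vars-[]ᵛ (ins b) ω) (subst (λ ts → _ ∈ₗ varsᵛ ts) ins-instance q)
      ... | x , x∈ , r = below (varsᵠ-++⁺ʳ F {b ∷ []} (inVars-⊆ {b ∷ []} {b} (here refl) x∈)) r

    fresh-instance : Terminating ((b ∷ []) [ κ ]ᵠ) → Instance F (b ∷ []) ω
    fresh-instance term = record
      { κ           = κ
      ; agrees      = λ x∈F _ → upd-∉ λ r → prefix-avoids F (RT.nice rt-b) (x∈F , ∈-++⁺ˡ r)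
      ; avoids      = λ x∈F _ w∈ out → <⇒≱ (below (varsᵠ-++⁺ˡ F x∈F) w∈) (outs-above (outs-[] out))
      ; renames     = λ q → subst IsVar (sym (upd-∈ (subst (_ ∈ₗ_) (++-identityʳ _) q))) (_ , refl)
      ; nice        = RT.nice instance-RT
      ; terminating = term
      }

  terminating-[] : Terminating []
  terminating-[] = acc λ step → case split-++ [] {us = _⇒_.before step} (_⇒_.split step) of λ
    { (inj₁ (_ , e , _)) → []≢++∷ (_⇒_.before step) e
    ; (inj₂ (ws , _ , e)) → []≢++∷ ws e }
    where
    []≢++∷ : ∀ {A : Set} {B : Set} (xs : List A) {y ys} → [] ≡ xs ++ y ∷ ys → B
    []≢++∷ []      ()
    []≢++∷ (_ ∷ _) ()

  prefixwise : ∀ {Q} → RT Q →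
               (∀ F b G → Q ≡ F ++ b ∷ G → Continuable F (b ∷ [])) → Terminating Q
  prefixwise {Q} rt k = go [] Q refl terminating-[]
    where
    go : ∀ F G → Q ≡ F ++ G → Terminating F → Terminating Q
    go F []      e term = subst Terminating (sym (trans e (++-identityʳ F))) term
    go F (b ∷ G) e term = go (F ++ b ∷ []) G e′
      (combine term (RT-++ˡ (F ++ b ∷ []) (subst RT e′ rt)) (k F b G e))
      where
      e′ : Q ≡ (F ++ b ∷ []) ++ G
      e′ = trans e (sym (++-assoc F (b ∷ []) G))

  module _ (p : Pred) (below-robust : ∀ q → P ⊢ p ⊐ q → Robust P q)
    (L : ModedTypedLevelMapping P)
    (recurrent : ∀ c → c ∈ₗ clauses P → P ⊢ pred (head c) ≈ p → WellRecurrent P L c)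
    where
    open ModedTypedLevelMapping L

    level-≡ : ∀ {a b} → a ≡ b → (ma : a ∈ 𝐁ᴵⁿᵖ P) (mb : b ∈ 𝐁ᴵⁿᵖ P) → level a ma ≡ level b mb
    level-≡ {a} refl = out-invariant {pred a} {ins a} {outs a} {outs a}

    level-ins : ∀ {q s s′ t t′} → s ≡ s′ → (m : atom q s t ∈ 𝐁ᴵⁿᵖ P) (m′ : atom q s′ t′ ∈ 𝐁ᴵⁿᵖ P) →
                level (atom q s t) m ≡ level (atom q s′ t′) m′
    level-ins {q} {s} {t = t} {t′} refl = out-invariant {q} {s} {t} {t′}

    level-[] : ∀ {a} σ (m : a ∈ 𝐁ᴵⁿᵖ P) (m′ : a [ σ ]ᵃ ∈ 𝐁ᴵⁿᵖ P) → level a m ≡ level (a [ σ ]ᵃ) m′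
    level-[] {a} σ m m′ = trans (subst-invariant {pred a} {ins a} {outs a} σ m m″)
                                (level-ins {pred a} {t = outs a} {outs a [ σ ]ᵛ} refl m″ m′)
      where
      m″ : atom (pred a) (ins a [ σ ]ᵛ) (outs a) ∈ 𝐁ᴵⁿᵖ P
      m″ = m′

    -- The bound `n` makes the induction on levels structural. All predicates equivalent to `p` are
    -- treated together, since recursion may pass through any of them.
    terminating-below : ∀ n {q s t} → P ⊢ q ≈ p → RT [ atom q s t ] →
                        (m : atom q s t ∈ 𝐁ᴵⁿᵖ P) → level (atom q s t) m < n → Terminating [ atom q s t ]

    resolvent-terminating : ∀ n {q s v t u B c η} → P ⊢ q ≈ p →
      (m : atom q s t ∈ 𝐁ᴵⁿᵖ P) → level (atom q s t) m ≤ n →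
      c ∈ₗ clauses P → Variant c (atom q v u ⟵ B) → Unifier (atom q s t) (atom q v u) η →
      RT (B [ η ]ᵠ) → Terminating (B [ η ]ᵠ)
    resolvent-terminating n {q} {s} {t = t} {c = c@(h₀ ⟵ B₀)} {η = η} (q⊒p , p⊒q) m m≤n c∈P
                          ((ρ , refl) , _) unif rt =
      prefixwise rt λ F b G e ω typed →
        fresh-instance (subst RT e rt) typed (instance-terminating F b G e ω typed)
      where
      instance-terminating : ∀ F b G (e : B₀ [ ρ ]ᵠ [ η ]ᵠ ≡ F ++ b ∷ G) ω (typed : All OutTyped (F [ ω ]ᵠ)) →
                             Terminating ((b ∷ []) [ freshened (subst RT e rt) typed ]ᵠ)
      instance-terminating F b G e ω typed = go
        where
        b∈ : ∃[ b₀ ] (b₀ ∈ₗ B₀ × b ≡ b₀ [ ρ ]ᵃ [ η ]ᵃ)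
        b∈ with ∈-map⁻ (_[ η ]ᵃ) (subst (b ∈ₗ_) (sym e) (∈-++⁺ʳ F (here refl)))
        ... | _ , b₁∈ , refl with ∈-map⁻ (_[ ρ ]ᵃ) b₁∈
        ... | b₀ , b₀∈ , refl = b₀ , b₀∈ , refl

        b₀ : Atom
        b₀ = proj₁ b∈

        pred-b : pred b ≡ pred b₀
        pred-b = cong pred (proj₂ (proj₂ b∈))

        refers : RefersTo P q (pred b)
        refers = Any.map (λ { refl → refl , Any.map (λ { refl → sym pred-b }) (proj₁ (proj₂ b∈)) }) c∈P

        occurs : OccursIn (pred b) P
        occurs = Any.map (λ { refl → there (Any.map (λ { refl → sym pred-b }) (proj₁ (proj₂ b∈))) }) c∈P

        rt′ : RT (F ++ b ∷ G)
        rt′ = subst RT e rt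

        -- Well-recurrence is stated for the program clause: `δ` leads from it through the variant
        -- and the resolution step to the typed instance.
        δ : Subst
        δ = ρ ⨟ (η ⨟ ω)

        bω : b₀ [ δ ]ᵃ ≡ b [ ω ]ᵃ
        bω = trans (sym (⨟-termᵃ b₀)) (trans (sym (⨟-termᵃ (b₀ [ ρ ]ᵃ)))
          (cong (_[ ω ]ᵃ) (sym (proj₂ (proj₂ b∈)))))

        aω : atom q s t [ η ⨟ ω ]ᵃ ≡ h₀ [ δ ]ᵃ
        aω = trans (unifies-⨟ (atom q s t) (h₀ [ ρ ]ᵃ) unif) (⨟-termᵃ h₀)

        a-m : atom q s t [ η ⨟ ω ]ᵃ ∈ 𝐁ᴵⁿᵖ P
        a-m = proj₁ m , InTyped-[] {atom q s t} (η ⨟ ω) (proj₂ m)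

        h-m : h₀ [ δ ]ᵃ ∈ 𝐁ᴵⁿᵖ P
        h-m = subst (𝐁ᴵⁿᵖ P) aω a-m

        b-m : b [ ω ]ᵃ ∈ 𝐁ᴵⁿᵖ P
        b-m = occurs , instance-typed rt′ typed

        b₀-m : b₀ [ δ ]ᵃ ∈ 𝐁ᴵⁿᵖ P
        b₀-m = subst (𝐁ᴵⁿᵖ P) (sym bω) b-m

        go : Terminating ((b ∷ []) [ freshened rt′ typed ]ᵠ)
        go with em {P = P ⊢ pred b ⊒ p}
        ... | no  b⋣p = robust-terminating
          (below-robust (pred b) (p⊒q ◅◅ refers ◅ ε , b⋣p)) (instance-RT rt′ typed)
        ... | yes b⊒p = terminating-below n {pred b} {t = outs b [ freshened rt′ typed ]ᵛ} 
          (b⊒p , p⊒q ◅◅ refers ◅ ε) (instance-RT rt′ typed) κ-m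
          -- The copy of `b` has the level of `b₀` under `δ`, as outputs do not count. The head
          -- under `δ` is an instance of the selected atom and so has its level.
          (<-≤-trans (subst₂ _<_
              (trans (level-≡ bω b₀-m b-m)
                (level-ins {pred b} {t = outs b [ ω ]ᵛ} {outs b [ freshened rt′ typed ]ᵛ}
                  (sym (ins-instance rt′ typed)) b-m κ-m))
              (trans (level-≡ (sym aω) h-m a-m) (sym (level-[] {atom q s t} (η ⨟ ω) m a-m)))
              (recurrent c c∈P (q⊒p , p⊒q) b₀ (proj₁ (proj₂ b∈))
                (subst (λ r → P ⊢ r ≈ q) pred-b (b⊒p ◅◅ p⊒q , refers ◅ ε)) δ b₀-m h-m))
            m≤n)
          where
          κ-m : b [ freshened rt′ typed ]ᵃ ∈ 𝐁ᴵⁿᵖ P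
          κ-m = occurs , subst InTyped ([]-idᵃ (b [ freshened rt′ typed ]ᵃ))
                           (proj₁ (RT.chain (instance-RT rt′ typed) var))

    terminating-below (suc n) {q} {s} {t} q≈p rt m (s≤s m≤n) = acc after-step
      where
      after-step : ∀ {Q′} → [ atom q s t ] ⇒ Q′ → Terminating Q′
      after-step step@(record { before = [] ; B = B ; split = refl ; clause∈P = c∈P ; variant = variant
                              ; η = η ; mgu = mgu ; result = refl }) =
        subst (λ R → Terminating (R [ η ]ᵠ)) (sym (++-identityʳ B))
          (resolvent-terminating n {s = s} {t = t} q≈p m m≤n c∈P variant (ConsumingMGU.unifies mgu)
            (subst (λ R → RT (R [ η ]ᵠ)) (++-identityʳ B) (⇒-RT rt step)))
      after-step record { before = _ ∷ [] ; split = () }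
      after-step record { before = _ ∷ _ ∷ _ ; split = () }

    level-robust : OccursIn p P → Robust P p
    level-robust occurs = terminating-robust λ s t rt →
      let m = occurs , subst InTyped ([]-idᵃ (atom p s t)) (proj₁ (RT.chain rt var))
      -- The bound is inferred to be the successor of the level of the initial atom.
      in terminating-below _ {p} {s} {t} (ε , ε) rt m ≤-refl

lemma5p9 :
    ExcludedMiddle 0ℓ →
    (S : Signature) (τ : Syntax.Typing S) →
    let open Syntax S
        open Typed S τ
    in
    (P : Program) →
    RobustlyTypedProgram P →
    InputLinear P →
    InputSelectability P →
    (p : Pred) → OccursIn p P →
    (∀ q → P ⊢ p ⊐ q → Robust P q) →
    (∃[ ∣·∣ ] (∀ c → c ∈ₗ clauses P → P ⊢ pred (head c) ≈ p → WellRecurrent P ∣·∣ c)) →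
    Robust P p
lemma5p9 em S τ P robust-program input-linear selectability p occurs below-robust (L , recurrent) =
  Levels.level-robust em S τ P robust-program input-linear selectability p below-robust L recurrent occurs
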